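{- Let $H=[P,Q;-Q^\top,R^\top]$ be a skew Hadamard matrix of size $2n$ in which $P,Q,R$ are negacirculant $n\times n$ matrices. Then $Q$ is nonsingular and $R=P$.
   Context: Skew Hadamard: $H\in\{\pm1\}^{m\times m}$ with $HH^\top=mI_m$ and $H+H^\top=2I_m$. An $n\times n$ matrix is negacirculant if there is $w=(w_0,\dots,w_{n-1})$ with $(i,j)$ entry $w_{j-i}$ for $j\ge i$ and $-w_{n+j-i}$ for $j<i$ (indices $0,\dots,n-1$). -}

module Defs where

open import Data.Nat using (ℕ; zero; suc; _≤ᵇ_; _∸_) renaming (_+_ to _+ℕ_)
open import Data.Fin using (Fin; zero; suc; toℕ; punchIn)
open import Data.Integer using (ℤ; +_; -_; _+_; _*_)
open import Data.Bool using (if_then_else_)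
open import Data.Product using (Σ; _×_)
open import Data.Sum using (_⊎_)
open import Relation.Binary.PropositionalEquality using (_≡_; _≢_)

Matrix : ℕ → Set
Matrix m = Fin m → Fin m → ℤ

∑ : ∀ {m} → (Fin m → ℤ) → ℤ
∑ {zero} f = + 0
∑ {suc m} f = f zero + ∑ (λ i → f (suc i))

transpose : ∀ {m} → Matrix m → Matrix m
transpose M i j = M j i

_·_ : ∀ {m} → Matrix m → Matrix m → Matrix m
(A · B) i j = ∑ (λ k → A i k * B k j)

scalarId : ∀ {m} → ℤ → Matrix m
scalarId c zero zero = c
scalarId c zero (suc j) = + 0
scalarId c (suc i) zero = + 0
scalarId c (suc i) (suc j) = scalarId c i j

_⊕_ : ∀ {m} → Matrix m → Matrix m → Matrix m
(A ⊕ B) i j = A i j + B i j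

IsSkewHadamard : ∀ m → Matrix m → Set
IsSkewHadamard m H =
  (∀ i j → (H i j ≡ + 1) ⊎ (H i j ≡ - (+ 1)))
  × (∀ i j → (H · transpose H) i j ≡ scalarId (+ m) i j)
  × (∀ i j → (H ⊕ transpose H) i j ≡ scalarId (+ 2) i j)

-- the k-th component of w (k < n in all uses; 0 out of range)
at : ∀ {n} → (Fin n → ℤ) → ℕ → ℤ
at {zero} w k = + 0
at {suc n} w zero = w zero
at {suc n} w (suc k) = at (λ i → w (suc i)) k

IsNegacirculant : ∀ n → Matrix n → Set
IsNegacirculant n M = Σ (Fin n → ℤ) λ w → ∀ i j →
  M i j ≡ (if toℕ i ≤ᵇ toℕ j
           then at w (toℕ j ∸ toℕ i)
           else - at w ((n +ℕ toℕ j) ∸ toℕ i))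

sgn : ℕ → ℤ
sgn zero = + 1
sgn (suc k) = - sgn k

det : ∀ {m} → Matrix m → ℤ
det {zero} M = + 1
det {suc m} M = ∑ (λ j → sgn (toℕ j) * (M zero j * det (λ r c → M (suc r) (punchIn j c))))

-- nonsingular (over ℚ/ℝ) : nonzero determinant
Nonsingular : ∀ {m} → Matrix m → Set
Nonsingular M = det M ≢ + 0

module Submission where

-- Identify the negacirculant matrix of w with Σ wₖ Tᵏ, where T is the shift on sequences with
-- f(k + n) = - f(k). Then P, Q, R commute and Rᵀ = 2 - R. If Q d = 0, then QᵀQ + RᵀR = 2n makes
-- σ = R - 1 satisfy σ² d = -(2n - 1) d, and this forces d = 0. Indeed three rows of H show that n is
-- even for n ≥ 2, so 2n - 1 ≡ 3 (mod 4) has a prime p of odd exponent. As p is prime to 2n, some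
-- power q of p is 1 modulo 2n, whence T^q = T, and Frobenius gives σ^q ≡ σ (mod p) in ℤ[T]; so σ d is
-- divisible by p within ℤ[T] d, and comparing exponents of p in σ² d = -(2n - 1) d leads to an
-- infinite descent. Hence Q has no right kernel, nor a left one since reversing the indices transposes
-- Q, and elimination gives det Q ≠ 0. Finally the off-diagonal block of H Hᵀ gives
-- Q R = P Q = Q P, so R = P.

-- The arithmetic is an elementary form of a ramification argument. Over ℂ the eigenvalues of T are
-- the ζ with ζ^n = -1. If Q vanished at ζ, the eigenvalue of σ there would be an element of ℤ[ζ]
-- with square -(2n - 1). A prime p of odd exponent in 2n - 1 ramifies in the field generated by
-- such a root, but not in ℚ(ζ), because p does not divide 2n. The congruence σ^q ≡ σ (mod p) is the
-- trace of this that survives in ℤ[T]: a suitable power of Frobenius acts trivially modulo p. It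
-- needs neither eigenvalues nor number fields. The price is that ℤ[T] modulo T^(2n) - 1 has zero
-- divisors, and that σ² = -(2n - 1) is known only on one vector. Hence operators are always applied
-- to a fixed sequence, and divisions by p are carried out on integer values.

open import Level using (_⊔_; 0ℓ)
open import Algebra.Bundles using (CommutativeRing)
open import Data.Fin using (Fin; zero; suc; toℕ; fromℕ; fromℕ<; inject₁; opposite; punchIn; punchOut; _≟_; _↑ˡ_; _↑ʳ_)
open import Data.Fin.Properties using (toℕ-inject₁; toℕ-fromℕ; toℕ-fromℕ<; toℕ-injective; toℕ<n; all?; pigeonhole; opposite-prop; opposite-involutive; punchIn-punchOut; punchInᵢ≢i; punchIn-injective; suc-injective)
open import Data.Nat using (ℕ; zero; suc; s≤s; z≤n; _∸_; _<_; _≤_; _≤ᵇ_; _!; NonZero)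
import Data.Nat as ℕ
import Data.Nat.Properties as ℕₚ
open import Data.Nat.Combinatorics using (_C_; nCn≡1; nCk≡n!/k![n-k]!; k![n∸k]!∣n!)
open import Data.Nat.Coprimality using (Coprime; coprime-divisor)
open import Data.Nat.Divisibility using (_∣_; divides; _∤_; _∣?_; ∣⇒≤; m∣m*n; ∣-refl)
import Data.Nat.Divisibility as ℕᵈ
open import Data.Nat.DivMod using (_%_; _/_; _mod_; m/n*n≡m; m≡m%n+[m/n]*n; m%n<n; %-distribˡ-*; m<n⇒m%n≡m; m<n⇒m/n≡0; [m+n]%n≡m%n; [m+kn]%n≡m%n; +-distrib-/-∣ˡ; n/n≡1)
open import Data.Nat.Induction using (<-rec)
open import Data.Nat.Primality using (Prime; euclidsLemma; prime⇒nonZero; prime⇒nonTrivial; ¬prime[0])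
open import Data.Nat.Primality.Factorisation using (factorise)
open import Data.Product using (Σ-syntax; ∃-syntax; _×_; _,_; proj₁; proj₂)
open import Data.Sum using (_⊎_; inj₁; inj₂; [_,_]′)
open import Relation.Nullary using (¬_; Dec; yes; no; contradiction)
import Relation.Binary.PropositionalEquality as ≡
open ≡ using (_≡_; _≢_)

-- Frobenius in a commutative ring

prime∤! : ∀ {p} → Prime p → ∀ k → k < p → p ∤ k !
prime∤! {p} pp zero _ p∣1 =
  ℕₚ.<⇒≱ (ℕ.nonTrivial⇒n>1 p {{prime⇒nonTrivial pp}}) (∣⇒≤ p∣1)
prime∤! pp (suc k) k<p p∣ with euclidsLemma (suc k) (k !) pp p∣
... | inj₁ p∣k+1 = ℕₚ.<⇒≱ k<p (∣⇒≤ p∣k+1)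
... | inj₂ p∣k!  = prime∤! pp k (ℕₚ.<-trans (ℕₚ.n<1+n k) k<p) p∣k!

prime∣C : ∀ {p} → Prime p → ∀ k → 0 < k → k < p → p ∣ p C k
prime∣C {zero} pp _ _ _ = contradiction pp ¬prime[0]
prime∣C {p@(suc m)} pp k 0<k k<p with euclidsLemma (p C k) (k ! ℕ.* (p ∸ k) !) pp p∣prod
  where
  instance _ = k ℕₚ.!* (p ∸ k) !≢0
  prod≡ : (p C k) ℕ.* (k ! ℕ.* (p ∸ k) !) ≡ p !
  prod≡ = ≡.trans (≡.cong (ℕ._* (k ! ℕ.* (p ∸ k) !)) (nCk≡n!/k![n-k]! (ℕₚ.<⇒≤ k<p)))
                  (m/n*n≡m (k![n∸k]!∣n! (ℕₚ.<⇒≤ k<p)))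
  p∣prod : p ∣ (p C k) ℕ.* (k ! ℕ.* (p ∸ k) !)
  p∣prod = ≡.subst (p ∣_) (≡.sym prod≡) (m∣m*n (m !))
... | inj₁ p∣C = p∣C
... | inj₂ p∣k!m! with euclidsLemma (k !) ((p ∸ k) !) pp p∣k!m!
... | inj₁ p∣k! = contradiction p∣k! (prime∤! pp k k<p)
... | inj₂ p∣m! = contradiction p∣m! (prime∤! pp (p ∸ k) (ℕₚ.∸-monoʳ-< 0<k (ℕₚ.<⇒≤ k<p)))

module Frobenius {c ℓ} (R : CommutativeRing c ℓ) where
  open CommutativeRing R hiding (zero)
  open import Algebra.Properties.CommutativeMonoid.Mult +-commutativeMonoid
    using (×-congʳ; ×-congˡ; ×-assocˡ; ×-homo-1; ×-distrib-+) renaming (_×_ to _·_)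
  open import Algebra.Properties.Semiring.Mult semiring using (×-comm-*)
  open import Algebra.Properties.Semiring.Exp semiring using (_^_; ^-congˡ; ^-assocʳ)
  open import Algebra.Properties.CommutativeSemiring.Exp commutativeSemiring using (^-distrib-*)
  open import Algebra.Properties.CommutativeSemiring.Binomial commutativeSemiring
    using (binomialTerm; theorem)
  open import Algebra.Properties.Semiring.Sum semiring using (sum; sum-init-last)
  open import Relation.Binary.Reasoning.Setoid setoid

  infix 4 _≡_[mod_]
  -- The quotient is kept as data: the operator divided by `p` in `divide-root` is built from it.
  record _≡_[mod_] (x y : Carrier) (p : ℕ) : Set (c ⊔ ℓ) where
    constructor _,_
    field
      quotient : Carrier
      equality : x ≈ y + p · quotient

  ·0 : ∀ n → n · 0# ≈ 0#
  ·0 zero = refl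
  ·0 (suc n) = trans (+-identityˡ _) (·0 n)

  module _ {p : ℕ} where

    ≈⇒mod : ∀ {x y} → x ≈ y → x ≡ y [mod p ]
    ≈⇒mod {x} {y} x≈y = 0# , (begin
      x           ≈⟨ x≈y ⟩
      y           ≈⟨ +-identityʳ y ⟨
      y + 0#      ≈⟨ +-congˡ (·0 p) ⟨
      y + p · 0#  ∎)

    mod-trans : ∀ {x y z} → x ≡ y [mod p ] → y ≡ z [mod p ] → x ≡ z [mod p ]
    mod-trans {x} {y} {z} (u , x≈) (v , y≈) = v + u , (begin
      x                      ≈⟨ x≈ ⟩
      y + p · u              ≈⟨ +-congʳ y≈ ⟩
      (z + p · v) + p · u    ≈⟨ +-assoc _ _ _ ⟩
      z + (p · v + p · u)    ≈⟨ +-congˡ (×-distrib-+ v u p) ⟨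
      z + p · (v + u)        ∎)

    mod-sym : ∀ {x y} → x ≡ y [mod p ] → y ≡ x [mod p ]
    mod-sym {x} {y} (u , x≈) = - u , (begin
      y                           ≈⟨ +-identityʳ y ⟨
      y + 0#                      ≈⟨ +-congˡ (·0 p) ⟨
      y + p · 0#                  ≈⟨ +-congˡ (×-congʳ p (-‿inverseʳ u)) ⟨
      y + p · (u + - u)           ≈⟨ +-congˡ (×-distrib-+ u (- u) p) ⟩
      y + (p · u + p · (- u))     ≈⟨ +-assoc _ _ _ ⟨
      (y + p · u) + p · (- u)     ≈⟨ +-congʳ x≈ ⟨
      x + p · (- u)               ∎)

    mod-+ : ∀ {x x′ y y′} → x ≡ x′ [mod p ] → y ≡ y′ [mod p ] → x + y ≡ x′ + y′ [mod p ]
    mod-+ {x} {x′} {y} {y′} (u , x≈) (v , y≈) = u + v , (begin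
      x + y                        ≈⟨ +-cong x≈ y≈ ⟩
      (x′ + p · u) + (y′ + p · v)  ≈⟨ interchange _ _ _ _ ⟩
      (x′ + y′) + (p · u + p · v)  ≈⟨ +-congˡ (×-distrib-+ u v p) ⟨
      (x′ + y′) + p · (u + v)      ∎)
      where open import Algebra.Properties.CommutativeSemigroup +-commutativeSemigroup using (interchange)

    mod-*ˡ : ∀ x {y y′} → y ≡ y′ [mod p ] → x * y ≡ x * y′ [mod p ]
    mod-*ˡ x {y} {y′} (v , y≈) = x * v , (begin
      x * y                  ≈⟨ *-congˡ y≈ ⟩
      x * (y′ + p · v)       ≈⟨ distribˡ _ _ _ ⟩
      x * y′ + x * (p · v)   ≈⟨ +-congˡ (×-comm-* p x v) ⟩
      x * y′ + p · (x * v)   ∎)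

    mod-* : ∀ {x x′ y y′} → x ≡ x′ [mod p ] → y ≡ y′ [mod p ] → x * y ≡ x′ * y′ [mod p ]
    mod-* {x} {x′} {y} {y′} x≡ y≡ = mod-trans (mod-*ˡ x y≡)
      (mod-trans (≈⇒mod (*-comm x y′)) (mod-trans (mod-*ˡ y′ x≡) (≈⇒mod (*-comm y′ x′))))

    mod-^ : ∀ {x y} n → x ≡ y [mod p ] → x ^ n ≡ y ^ n [mod p ]
    mod-^ zero _ = ≈⇒mod refl
    mod-^ (suc n) x≡ = mod-* x≡ (mod-^ n x≡)

    mod-sum : ∀ {n} (t : Fin n → Carrier) → (∀ i → t i ≡ 0# [mod p ]) → sum t ≡ 0# [mod p ]
    mod-sum {zero} t t≡ = ≈⇒mod refl
    mod-sum {suc n} t t≡ =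
      mod-trans (mod-+ (t≡ zero) (mod-sum (λ i → t (suc i)) (λ i → t≡ (suc i)))) (≈⇒mod (+-identityˡ 0#))

    multiple-mod : ∀ {n} → p ∣ n → ∀ x → n · x ≡ 0# [mod p ]
    multiple-mod {n} (divides q n≡) x = q · x , (begin
      n · x               ≈⟨ ×-congˡ (≡.trans n≡ (ℕₚ.*-comm q p)) ⟩
      (p ℕ.* q) · x       ≈⟨ ×-assocˡ x p q ⟨
      p · (q · x)         ≈⟨ +-identityˡ _ ⟨
      0# + p · (q · x)    ∎)

  ^p-+ : ∀ {p} → Prime p → ∀ x y → (x + y) ^ p ≡ x ^ p + y ^ p [mod p ]
  ^p-+ {zero} pp = contradiction pp ¬prime[0]
  ^p-+ {p@(suc m)} pp x y =
    mod-trans (≈⇒mod (theorem p x y)) (mod-trans (mod-+ (≈⇒mod first) rest) (≈⇒mod reorder))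
    where
    tail : Fin p → Carrier
    tail i = binomialTerm x y p (suc i)
    first : binomialTerm x y p zero ≈ y ^ p
    first = trans (×-homo-1 _) (*-identityˡ _)
    last : tail (fromℕ m) ≈ x ^ p
    last = begin
      (p C toℕ (suc (fromℕ m))) · (x ^ toℕ (suc (fromℕ m)) * y ^ (p ∸ toℕ (suc (fromℕ m))))
        ≡⟨ ≡.cong (λ k → (p C suc k) · (x ^ suc k * y ^ (p ∸ suc k))) (toℕ-fromℕ m) ⟩
      (p C p) · (x ^ p * y ^ (m ∸ m))
        ≡⟨ ≡.cong₂ (λ k e → k · (x ^ p * y ^ e)) (nCn≡1 p) (ℕₚ.n∸n≡0 m) ⟩
      1 · (x ^ p * 1#)  ≈⟨ ×-homo-1 _ ⟩
      x ^ p * 1#        ≈⟨ *-identityʳ _ ⟩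
      x ^ p             ∎
    middle : sum (λ i → tail (inject₁ i)) ≡ 0# [mod p ]
    middle = mod-sum _ λ i → multiple-mod (prime∣C pp (suc (toℕ (inject₁ i))) (s≤s z≤n)
      (s≤s (≡.subst (_< m) (≡.sym (toℕ-inject₁ i)) (toℕ<n i)))) _
    rest : sum tail ≡ 0# + x ^ p [mod p ]
    rest = mod-trans (≈⇒mod (sum-init-last tail)) (mod-+ middle (≈⇒mod last))
    reorder : y ^ p + (0# + x ^ p) ≈ x ^ p + y ^ p
    reorder = trans (+-congˡ (+-identityˡ _)) (+-comm _ _)

  ^p^j-+ : ∀ {p} → Prime p → ∀ j x y → (x + y) ^ (p ℕ.^ j) ≡ x ^ (p ℕ.^ j) + y ^ (p ℕ.^ j) [mod p ]
  ^p^j-+ pp zero x y = ≈⇒mod (trans (*-identityʳ _) (sym (+-cong (*-identityʳ x) (*-identityʳ y))))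
  ^p^j-+ {p} pp (suc j) x y =
    mod-trans (≈⇒mod (sym (^-assocʳ (x + y) p q)))
    (mod-trans (mod-^ q (^p-+ pp x y))
    (mod-trans (^p^j-+ pp j (x ^ p) (y ^ p))
    (≈⇒mod (+-cong (^-assocʳ x p q) (^-assocʳ y p q)))))
    where q = p ℕ.^ j

  module FixedByFrobenius {p : ℕ} (pp : Prime p) (j : ℕ) where
    q = p ℕ.^ j

    -- Modulo p the q-th power map respects sums and products, so its fixed elements form a subring.
    -- For polynomials in the shift it then suffices to look at the constants and at the shift
    -- itself.
    Fixed : Carrier → Set _
    Fixed x = x ^ q ≡ x [mod p ]

    private
      instance
        p≢0 : NonZero p
        p≢0 = prime⇒nonZero pp
        q≢0 : NonZero q
        q≢0 = ℕₚ.m^n≢0 p j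

    fixed-cong : ∀ {x y} → x ≈ y → Fixed x → Fixed y
    fixed-cong x≈y fx = mod-trans (≈⇒mod (^-congˡ q (sym x≈y))) (mod-trans fx (≈⇒mod x≈y))

    fixed-0 : Fixed 0#
    fixed-0 = ≈⇒mod (0^ q)
      where
      0^ : ∀ n → .{{_ : NonZero n}} → 0# ^ n ≈ 0#
      0^ (suc n) = zeroˡ _

    fixed-1 : Fixed 1#
    fixed-1 = ≈⇒mod (1^ q)
      where
      1^ : ∀ n → 1# ^ n ≈ 1#
      1^ zero = refl
      1^ (suc n) = trans (*-identityˡ _) (1^ n)

    fixed-+ : ∀ {x y} → Fixed x → Fixed y → Fixed (x + y)
    fixed-+ fx fy = mod-trans (^p^j-+ pp j _ _) (mod-+ fx fy)

    fixed-* : ∀ {x y} → Fixed x → Fixed y → Fixed (x * y)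
    fixed-* fx fy = mod-trans (≈⇒mod (^-distrib-* _ _ q)) (mod-* fx fy)

    -- Since y^q + x^q ≡ (y + x)^q = 0, the sign of (-1)^q, and with it the parity of q, never has
    -- to be discussed.
    fixed-inverse : ∀ {x y} → y + x ≈ 0# → Fixed x → Fixed y
    fixed-inverse {x} {y} y+x≈0 fx =
      mod-trans (≈⇒mod (insert (y ^ q))) (mod-trans (mod-+ cancelled (≈⇒mod refl)) (≈⇒mod (+-identityˡ y)))
      where
      insert : ∀ z → z ≈ (z + x) + y
      insert z = sym (trans (+-assoc z x y) (trans (+-congˡ (trans (+-comm x y) y+x≈0)) (+-identityʳ z)))
      cancelled : y ^ q + x ≡ 0# [mod p ]
      cancelled = mod-trans (mod-+ (≈⇒mod refl) (mod-sym fx))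
        (mod-trans (mod-sym (^p^j-+ pp j y x))
        (mod-trans (≈⇒mod (^-congˡ q y+x≈0)) fixed-0))

open import Defs
open import Data.Bool using (T; true; false; if_then_else_)
open import Data.Empty using (⊥)
open import Data.Integer using (ℤ; +_; -[1+_]; -_; _+_; _*_; _^_; ∣_∣)
import Data.Integer as ℤ
import Data.Integer.Divisibility.Signed as ℤᵈ
import Data.Integer.Properties as ℤₚ
open import Data.Integer.Tactic.RingSolver using (solve-∀)
open import Data.List using ([]; _∷_)
open import Data.List.Relation.Unary.All using (_∷_)
open import Algebra.Properties.AbelianGroup ℤₚ.+-0-abelianGroup using (∙-cancelˡ)
open import Algebra.Properties.CommutativeSemigroup ℤₚ.+-commutativeSemigroup using (interchange)
open import Algebra.Properties.CommutativeSemigroup ℤₚ.*-commutativeSemigroup using (x∙yz≈y∙xz)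
open import Function using (_∘_; case_of_)
open import Relation.Nullary.Decidable using (toWitness; _→-dec_)
open import Relation.Binary.PropositionalEquality
open ≡-Reasoning

-- Polynomials in the shift

Seq : Set
Seq = ℕ → ℤ

-- Expressions instead of coefficient lists: operators are compared only through their action, so no
-- normal form is needed, and `frobenius-fixes` becomes an induction on the expression.
data ShiftPoly : Set where
  const   : ℤ → ShiftPoly
  shift   : ShiftPoly
  _⊞_ _⊠_ : ShiftPoly → ShiftPoly → ShiftPoly

infixl 6 _⊞_
infixl 7 _⊠_

⟦_⟧ : ShiftPoly → Seq → Seq
⟦ const c ⟧ f k = c * f k
⟦ shift ⟧ f k = f (suc k)
⟦ A ⊞ B ⟧ f k = ⟦ A ⟧ f k + ⟦ B ⟧ f k
⟦ A ⊠ B ⟧ f = ⟦ A ⟧ (⟦ B ⟧ f)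

act-cong : ∀ A {f g} → f ≗ g → ⟦ A ⟧ f ≗ ⟦ A ⟧ g
act-cong (const c) f≗g k = cong (c *_) (f≗g k)
act-cong shift f≗g k = f≗g (suc k)
act-cong (A ⊞ B) f≗g k = cong₂ _+_ (act-cong A f≗g k) (act-cong B f≗g k)
act-cong (A ⊠ B) f≗g = act-cong A (act-cong B f≗g)

act-+ : ∀ A f g k → ⟦ A ⟧ (λ i → f i + g i) k ≡ ⟦ A ⟧ f k + ⟦ A ⟧ g k
act-+ (const c) f g k = ℤₚ.*-distribˡ-+ c (f k) (g k)
act-+ shift f g k = refl
act-+ (A ⊞ B) f g k = trans (cong₂ _+_ (act-+ A f g k) (act-+ B f g k)) (interchange (⟦ A ⟧ f k) _ _ _)
act-+ (A ⊠ B) f g k = trans (act-cong A (act-+ B f g) k) (act-+ A (⟦ B ⟧ f) (⟦ B ⟧ g) k)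

act-* : ∀ A c f k → ⟦ A ⟧ (λ i → c * f i) k ≡ c * ⟦ A ⟧ f k
act-* (const d) c f k = x∙yz≈y∙xz d c (f k)
act-* shift c f k = refl
act-* (A ⊞ B) c f k = trans (cong₂ _+_ (act-* A c f k) (act-* B c f k)) (sym (ℤₚ.*-distribˡ-+ c _ _))
act-* (A ⊠ B) c f k = trans (act-cong A (act-* B c f) k) (act-* A c (⟦ B ⟧ f) k)

act-shift : ∀ A m f k → ⟦ A ⟧ (λ i → f (m ℕ.+ i)) k ≡ ⟦ A ⟧ f (m ℕ.+ k)
act-shift (const c) m f k = refl
act-shift shift m f k = cong f (ℕₚ.+-suc m k)
act-shift (A ⊞ B) m f k = cong₂ _+_ (act-shift A m f k) (act-shift B m f k)
act-shift (A ⊠ B) m f k = trans (act-cong A (act-shift B m f) k) (act-shift A m (⟦ B ⟧ f) k)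

act-comm : ∀ A B f k → ⟦ A ⟧ (⟦ B ⟧ f) k ≡ ⟦ B ⟧ (⟦ A ⟧ f) k
act-comm (const c) B f k = sym (act-* B c f k)
act-comm shift B f k = sym (act-shift B 1 f k)
act-comm (A ⊞ B) E f k =
  trans (cong₂ _+_ (act-comm A E f k) (act-comm B E f k)) (sym (act-+ E (⟦ A ⟧ f) (⟦ B ⟧ f) k))
act-comm (A ⊠ B) E f k =
  trans (act-cong A (act-comm B E f) k) (act-comm A E (⟦ B ⟧ f) k)

module Periodicity (L : ℕ) where

  Periodic : Seq → Set
  Periodic f = ∀ k → f (L ℕ.+ k) ≡ f k

  act-periodic : ∀ A {f} → Periodic f → Periodic (⟦ A ⟧ f)
  act-periodic A {f} per k = trans (sym (act-shift A L f k)) (act-cong A per k)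

  infix 4 _≈_
  record _≈_ (A B : ShiftPoly) : Set where
    constructor agree
    field on : ∀ {f} → Periodic f → ⟦ A ⟧ f ≗ ⟦ B ⟧ f
  open _≈_ public

  negate : ShiftPoly → ShiftPoly
  negate A = const (- + 1) ⊠ A

  -- The setoid equality makes this the quotient of ℤ[T] by Tᴸ - 1.
  cyclicRing : CommutativeRing 0ℓ 0ℓ
  cyclicRing = record
    { Carrier = ShiftPoly ; _≈_ = _≈_ ; _+_ = _⊞_ ; _*_ = _⊠_ ; -_ = negate
    ; 0# = const (+ 0) ; 1# = const (+ 1)
    ; isCommutativeRing = record
      { isRing = record
        { +-isAbelianGroup = record
          { isGroup = record
            { isMonoid = record
              { isSemigroup = record
                { isMagma = record
                  { isEquivalence = record
                    { refl = agree λ _ _ → refl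
                    ; sym = λ e → agree λ per k → sym (on e per k)
                    ; trans = λ e e′ → agree λ per k → trans (on e per k) (on e′ per k) }
                  ; ∙-cong = λ e e′ → agree λ per k → cong₂ _+_ (on e per k) (on e′ per k) }
                ; assoc = λ A B E → agree λ {f} _ k → ℤₚ.+-assoc (⟦ A ⟧ f k) _ _ }
              ; identity = (λ A → agree λ _ k → ℤₚ.+-identityˡ _) , (λ A → agree λ _ k → ℤₚ.+-identityʳ _) }
            ; inverse = (λ A → agree λ {f} _ k → inverseˡ (⟦ A ⟧ f k))
                      , (λ A → agree λ {f} _ k → inverseʳ (⟦ A ⟧ f k))
            ; ⁻¹-cong = λ e → agree λ per k → cong (- + 1 *_) (on e per k) }
          ; comm = λ A B → agree λ {f} _ k → ℤₚ.+-comm (⟦ A ⟧ f k) _ }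
        ; *-cong = λ {A} {A′} {B} {B′} e e′ → agree λ per k →
            trans (act-cong A (on e′ per) k) (on e (act-periodic B′ per) k)
        ; *-assoc = λ A B E → agree λ _ _ → refl
        ; *-identity = (λ A → agree λ _ k → ℤₚ.*-identityˡ _)
                     , (λ A → agree λ _ k → act-cong A (λ _ → ℤₚ.*-identityˡ _) k)
        ; distrib = (λ A B E → agree λ {f} _ k → act-+ A (⟦ B ⟧ f) (⟦ E ⟧ f) k)
                  , (λ A B E → agree λ _ _ → refl) }
      ; *-comm = λ A B → agree λ {f} _ k → act-comm A B f k } }
    where
    inverseˡ : ∀ x → - + 1 * x + x ≡ + 0 * x
    inverseˡ = solve-∀
    inverseʳ : ∀ x → x + - + 1 * x ≡ + 0 * x
    inverseʳ = solve-∀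

-- Square roots of -N on periodic sequences

toℕ-mod : ∀ m n .{{_ : NonZero n}} → toℕ (m mod n) ≡ m % n
toℕ-mod m n = toℕ-fromℕ< (m%n<n m n)

cancel-power : ∀ {p L} → Coprime L p → ∀ i {m} → L ∣ p ℕ.^ i ℕ.* m → L ∣ m
cancel-power c zero {m} d = subst (_ ∣_) (ℕₚ.+-identityʳ m) d
cancel-power {p} {L} c (suc i) {m} d =
  cancel-power c i (coprime-divisor c (subst (L ∣_) (ℕₚ.*-assoc p (p ℕ.^ i) m) d))

%-equal⇒∣∸ : ∀ a b L .{{_ : NonZero L}} → a % L ≡ b % L → L ∣ b ℕ.∸ a
%-equal⇒∣∸ a b L a%≡b% = divides (b / L ℕ.∸ a / L) (begin
  b ℕ.∸ a
    ≡⟨ cong₂ ℕ._∸_ (m≡m%n+[m/n]*n b L) (m≡m%n+[m/n]*n a L) ⟩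
  (b % L ℕ.+ b / L ℕ.* L) ℕ.∸ (a % L ℕ.+ a / L ℕ.* L)
    ≡⟨ cong (λ r → (b % L ℕ.+ b / L ℕ.* L) ℕ.∸ (r ℕ.+ a / L ℕ.* L)) a%≡b% ⟩
  (b % L ℕ.+ b / L ℕ.* L) ℕ.∸ (b % L ℕ.+ a / L ℕ.* L)
    ≡⟨ ℕₚ.[m+n]∸[m+o]≡n∸o (b % L) _ _ ⟩
  b / L ℕ.* L ℕ.∸ a / L ℕ.* L
    ≡⟨ ℕₚ.*-distribʳ-∸ L (b / L) (a / L) ⟨
  (b / L ℕ.∸ a / L) ℕ.* L ∎)

-- Two of the powers with exponents 0, ..., L agree modulo `L`, and the smaller one can be cancelled
-- since `p` is prime to `L`. The exponent left over is positive, which `divide-root` needs in order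
-- to have a power greater than 1.
power≡1-mod : ∀ p L .{{_ : NonZero p}} .{{_ : NonZero L}} → Coprime L p →
              ∃[ j ] ∃[ m ] p ℕ.^ suc j ≡ 1 ℕ.+ m ℕ.* L
power≡1-mod p L c
  with a , b , a<b , eq ← pigeonhole (ℕₚ.n<1+n L) (λ i → (p ℕ.^ toℕ i) mod L)
  with d , b≡ ← ℕₚ.m≤n⇒∃[o]m+o≡n a<b
  = d , ℕᵈ.quotient L∣ , (begin
      p ℕ.^ suc d                           ≡⟨ ℕₚ.m+[n∸m]≡n (ℕₚ.m^n>0 p (suc d)) ⟨
      1 ℕ.+ (p ℕ.^ suc d ℕ.∸ 1)             ≡⟨ cong suc (ℕᵈ._∣_.equality L∣) ⟩
      1 ℕ.+ ℕᵈ.quotient L∣ ℕ.* L            ∎)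
  where
  same : p ℕ.^ toℕ a % L ≡ p ℕ.^ toℕ b % L
  same = trans (sym (toℕ-mod _ L)) (trans (cong toℕ eq) (toℕ-mod _ L))
  split : p ℕ.^ toℕ b ℕ.∸ p ℕ.^ toℕ a ≡ p ℕ.^ toℕ a ℕ.* (p ℕ.^ suc d ℕ.∸ 1)
  split = begin
    p ℕ.^ toℕ b ℕ.∸ p ℕ.^ toℕ a
      ≡⟨ cong (λ e → p ℕ.^ e ℕ.∸ p ℕ.^ toℕ a) (trans (sym b≡) (sym (ℕₚ.+-suc (toℕ a) d))) ⟩
    p ℕ.^ (toℕ a ℕ.+ suc d) ℕ.∸ p ℕ.^ toℕ a
      ≡⟨ cong₂ ℕ._∸_ (ℕₚ.^-distribˡ-+-* p (toℕ a) (suc d)) (sym (ℕₚ.*-identityʳ (p ℕ.^ toℕ a))) ⟩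
    p ℕ.^ toℕ a ℕ.* p ℕ.^ suc d ℕ.∸ p ℕ.^ toℕ a ℕ.* 1
      ≡⟨ ℕₚ.*-distribˡ-∸ (p ℕ.^ toℕ a) (p ℕ.^ suc d) 1 ⟨
    p ℕ.^ toℕ a ℕ.* (p ℕ.^ suc d ℕ.∸ 1) ∎
  L∣ : L ∣ p ℕ.^ suc d ℕ.∸ 1
  L∣ = cancel-power c (toℕ a) (subst (L ∣_) split (%-equal⇒∣∸ _ _ L same))

-- An even p would make the product 0 modulo 4, and an odd square is 1; the sixteen pairs of
-- residues are settled by computation.
square*≡3-mod-4 : ∀ p m → (p ℕ.* (p ℕ.* m)) % 4 ≡ 3 → m % 4 ≡ 3
square*≡3-mod-4 p m h = begin
  m % 4                    ≡⟨ toℕ-mod m 4 ⟨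
  toℕ (m mod 4)            ≡⟨ table (p mod 4) (m mod 4) 
                                  (trans (cong₂ f (toℕ-mod p 4) (toℕ-mod m 4)) (trans (sym reduce) h)) ⟩
  3 ∎
  where
  f : ℕ → ℕ → ℕ
  f x y = (x ℕ.* ((x ℕ.* y) % 4)) % 4
  table : ∀ (x y : Fin 4) → f (toℕ x) (toℕ y) ≡ 3 → toℕ y ≡ 3
  table = toWitness {a? = all? λ x → all? λ y → (f (toℕ x) (toℕ y) ℕₚ.≟ 3) →-dec (toℕ y ℕₚ.≟ 3)} _
  reduce : (p ℕ.* (p ℕ.* m)) % 4 ≡ f (p % 4) (m % 4)
  reduce = trans (%-distribˡ-* p (p ℕ.* m) 4) (cong (λ z → ((p % 4) ℕ.* z) % 4) (%-distribˡ-* p m 4))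

primeDivisor : ∀ n → 1 < n → ∃[ p ] Prime p × p ∣ n
primeDivisor n@(suc _) 1<n with factorise n
... | record { factors = [] ; isFactorisation = n≡1 } = contradiction n≡1 (ℕₚ.>⇒≢ 1<n)
... | record { factors = p ∷ ps ; isFactorisation = n≡ ; factorsPrime = pp ∷ _ } =
  p , pp , subst (p ∣_) (sym n≡) (ℕᵈ.m∣m*n _)

-- Divisibility and descent for square roots acting on 2n-periodic sequences

module _ (n : ℕ) .{{_ : NonZero n}} where
  private
    -- An even period makes every q = 1 + m L odd, so that σ^q is σ times a power of σ².
    L = n ℕ.+ n
    instance
      L≢0 : NonZero L
      L≢0 = ℕ.>-nonZero (ℕₚ.≤-trans (ℕ.>-nonZero⁻¹ n) (ℕₚ.m≤m+n n n))

  open Periodicity L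
  open Frobenius cyclicRing
  open CommutativeRing cyclicRing using (semiring; +-monoid)
  open import Algebra.Properties.Semiring.Exp semiring using () renaming (_^_ to _^ᴿ_)
  open import Algebra.Properties.Monoid.Mult +-monoid using () renaming (_×_ to _·ᴿ_)

  act-·ᴿ : ∀ m A f k → ⟦ m ·ᴿ A ⟧ f k ≡ + m * ⟦ A ⟧ f k
  act-·ᴿ zero A f k = refl
  act-·ᴿ (suc m) A f k = trans (cong (λ z → ⟦ A ⟧ f k + z) (act-·ᴿ m A f k)) (collect (⟦ A ⟧ f k) (+ m))
    where
    collect : ∀ x y → x + y * x ≡ (+ 1 + y) * x
    collect = solve-∀

  act-shift^ : ∀ m f k → ⟦ shift ^ᴿ m ⟧ f k ≡ f (m ℕ.+ k)
  act-shift^ zero f k = ℤₚ.*-identityˡ (f k)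
  act-shift^ (suc m) f k = trans (act-shift^ m f (suc k)) (cong f (ℕₚ.+-suc m k))

  periodic-multiple : ∀ m {f} → Periodic f → ∀ k → f (m ℕ.* L ℕ.+ k) ≡ f k
  periodic-multiple zero per k = refl
  periodic-multiple (suc m) {f} per k =
    trans (cong f (ℕₚ.+-assoc L (m ℕ.* L) k)) (trans (per _) (periodic-multiple m per k))

  -- The generators are fixed: a constant is a sum of ones or the negative of such a sum, and T^q =
  -- T^(1 + m L) = T on sequences of period L.
  frobenius-fixes : ∀ {p} → Prime p → ∀ j m → p ℕ.^ j ≡ 1 ℕ.+ m ℕ.* L →
                    ∀ A → A ^ᴿ (p ℕ.^ j) ≡ A [mod p ]
  frobenius-fixes {p} pp j m q≡ = fixed
    where
    open FixedByFrobenius pp j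
    fixed-const⁺ : ∀ c → Fixed (const (+ c))
    fixed-const⁺ zero = fixed-0
    fixed-const⁺ (suc c) = fixed-cong (agree λ {f} _ k → collect (f k) (+ c)) (fixed-+ fixed-1 (fixed-const⁺ c))
      where
      collect : ∀ x c → + 1 * x + c * x ≡ (+ 1 + c) * x
      collect = solve-∀
    fixed : ∀ A → Fixed A
    fixed (const (+ c)) = fixed-const⁺ c
    fixed (const -[1+ c ]) = fixed-inverse {const (+ suc c)}
      (agree λ {f} _ k → trans (sym (ℤₚ.*-distribʳ-+ (f k) -[1+ c ] (+ suc c)))
                               (cong (_* f k) (ℤₚ.+-inverseˡ (+ suc c))))
      (fixed-const⁺ (suc c))
    fixed shift = ≈⇒mod (agree λ {f} per k → trans (act-shift^ (p ℕ.^ j) f k)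
      (trans (cong f (trans (cong (ℕ._+ k) q≡) (sym (ℕₚ.+-suc (m ℕ.* L) k)))) (periodic-multiple m per (suc k))))
    fixed (A ⊞ B) = fixed-+ (fixed A) (fixed B)
    fixed (A ⊠ B) = fixed-* (fixed A) (fixed B)

  -- The relation σ² = c is imposed on a single sequence, because it cannot be expected of the
  -- operator σ as a whole.
  SquareRoot : ShiftPoly → ℤ → Seq → Set
  SquareRoot σ c f = ∀ k → ⟦ σ ⟧ (⟦ σ ⟧ f) k ≡ c * f k

  act-even-power : ∀ σ c {f} → SquareRoot σ c f → ∀ e k → ⟦ σ ^ᴿ (e ℕ.+ e) ⟧ f k ≡ c ^ e * f k
  act-even-power σ c root zero k = refl
  act-even-power σ c {f} root (suc e) k = begin
    ⟦ σ ⟧ (⟦ σ ^ᴿ (e ℕ.+ suc e) ⟧ f) k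
      ≡⟨ cong (λ m → ⟦ σ ⟧ (⟦ σ ^ᴿ m ⟧ f) k) (ℕₚ.+-suc e e) ⟩
    ⟦ σ ⟧ (⟦ σ ⟧ (⟦ σ ^ᴿ (e ℕ.+ e) ⟧ f)) k
      ≡⟨ act-cong σ (act-cong σ (act-even-power σ c root e)) k ⟩
    ⟦ σ ⟧ (⟦ σ ⟧ (λ i → c ^ e * f i)) k
      ≡⟨ trans (act-cong σ (act-* σ (c ^ e) f) k) (act-* σ (c ^ e) (⟦ σ ⟧ f) k) ⟩
    c ^ e * ⟦ σ ⟧ (⟦ σ ⟧ f) k
      ≡⟨ cong (c ^ e *_) (root k) ⟩
    c ^ e * (c * f k)
      ≡⟨ regroup (c ^ e) c (f k) ⟩
    c ^ suc e * f k ∎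
    where
    regroup : ∀ x y z → x * (y * z) ≡ (y * x) * z
    regroup = solve-∀

  -- σ ≡ σ^q (mod p) with q odd, and σ^q f is a multiple of (p d) ^ ((q - 1) / 2), hence of p.
  divide-root : ∀ {p} → Prime p → Coprime L p → ∀ σ d {f} → Periodic f → SquareRoot σ (+ p * d) f →
                ∃[ τ ] ∀ k → ⟦ σ ⟧ f k ≡ + p * ⟦ τ ⟧ f k
  divide-root {p} pp cop σ d {f} per root
    with j , m , q≡ ← power≡1-mod p L {{prime⇒nonZero pp}} cop
    with E , σ^q≈ ← frobenius-fixes pp (suc j) m q≡ σ
    with m
  ... | zero = contradiction q≡ (ℕₚ.>⇒≢ (ℕₚ.≤-trans (ℕ.nonTrivial⇒n>1 p {{prime⇒nonTrivial pp}})
                 (ℕₚ.m≤m*n p (p ℕ.^ j) {{ℕₚ.m^n≢0 p j {{prime⇒nonZero pp}}}})))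
  -- Frobenius gives σ^q = σ + p E, while σ^q f = (p d)^e σ f with e = m n. As e is positive, (p
  -- d)^e = p c with c = d (p d)^(e - 1), and therefore σ f = p (c σ - E) f.
  ... | m@(suc m′) = const c ⊠ σ ⊞ const (- + 1) ⊠ E , λ k → begin
    ⟦ σ ⟧ f k
      ≡⟨ isolate (⟦ σ ⟧ f k) (+ p * ⟦ E ⟧ f k) ⟩
    (⟦ σ ⟧ f k + + p * ⟦ E ⟧ f k) + - + 1 * (+ p * ⟦ E ⟧ f k)
      ≡⟨ cong (λ z → (⟦ σ ⟧ f k + z) + - + 1 * (+ p * ⟦ E ⟧ f k)) (act-·ᴿ p E f k) ⟨
    (⟦ σ ⟧ f k + ⟦ p ·ᴿ E ⟧ f k) + - + 1 * (+ p * ⟦ E ⟧ f k)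
      ≡⟨ cong (_+ - + 1 * (+ p * ⟦ E ⟧ f k)) (trans (sym (on σ^q≈ per k)) (power k)) ⟩
    (+ p * d) ^ e * ⟦ σ ⟧ f k + - + 1 * (+ p * ⟦ E ⟧ f k)
      ≡⟨ cong (λ z → z * ⟦ σ ⟧ f k + - + 1 * (+ p * ⟦ E ⟧ f k)) e-power ⟩
    + p * c * ⟦ σ ⟧ f k + - + 1 * (+ p * ⟦ E ⟧ f k)
      ≡⟨ factor (+ p) c (⟦ σ ⟧ f k) (⟦ E ⟧ f k) ⟩
    + p * (c * ⟦ σ ⟧ f k + - + 1 * ⟦ E ⟧ f k) ∎
    where
    e = m ℕ.* n
    e′ = ℕ.pred e
    c = d * (+ p * d) ^ e′
    e≡ : e ≡ suc e′
    e≡ = sym (ℕₚ.suc-pred e {{ℕₚ.m*n≢0 m n}})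
    e-power : (+ p * d) ^ e ≡ + p * c
    e-power = trans (cong ((+ p * d) ^_) e≡) (ℤₚ.*-assoc (+ p) d _)
    isolate : ∀ x y → x ≡ (x + y) + - + 1 * y
    isolate = solve-∀
    factor : ∀ p c x y → p * c * x + - + 1 * (p * y) ≡ p * (c * x + - + 1 * y)
    factor = solve-∀
    power : ∀ k → ⟦ σ ^ᴿ (p ℕ.^ suc j) ⟧ f k ≡ (+ p * d) ^ e * ⟦ σ ⟧ f k
    power k = begin
      ⟦ σ ^ᴿ (p ℕ.^ suc j) ⟧ f k
        ≡⟨ cong (λ q → ⟦ σ ^ᴿ q ⟧ f k) (trans q≡ (cong suc (ℕₚ.*-distribˡ-+ m n n))) ⟩
      ⟦ σ ⟧ (⟦ σ ^ᴿ (e ℕ.+ e) ⟧ f) k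
        ≡⟨ act-cong σ (act-even-power σ (+ p * d) root e) k ⟩
      ⟦ σ ⟧ (λ i → (+ p * d) ^ e * f i) k
        ≡⟨ act-* σ ((+ p * d) ^ e) f k ⟩
      (+ p * d) ^ e * ⟦ σ ⟧ f k ∎

  -- Because σ and τ commute, σ f = p τ f can be used twice: p² τ² f = σ² f = p d f, and one p
  -- cancels. If p does not divide d, this forces p to divide f; if d = p d′, it makes τ a root of
  -- d′.
  divide-root² : ∀ {p} → Prime p → Coprime L p → ∀ σ d {f} → Periodic f → SquareRoot σ (+ p * d) f →
                 ∃[ τ ] ∀ k → + p * ⟦ τ ⟧ (⟦ τ ⟧ f) k ≡ d * f k
  divide-root² {p} pp cop σ d {f} per root with τ , σf≡pτf ← divide-root pp cop σ d per root =
    τ , λ k → ℤₚ.*-cancelˡ-≡ (+ p) _ _ {{prime⇒nonZero pp}} (begin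
      + p * (+ p * ⟦ τ ⟧ (⟦ τ ⟧ f) k)
        ≡⟨ cong (+ p *_) (act-* τ (+ p) (⟦ τ ⟧ f) k) ⟨
      + p * ⟦ τ ⟧ (λ i → + p * ⟦ τ ⟧ f i) k
        ≡⟨ cong (+ p *_) (act-cong τ σf≡pτf k) ⟨
      + p * ⟦ τ ⟧ (⟦ σ ⟧ f) k
        ≡⟨ cong (+ p *_) (act-comm τ σ f k) ⟩
      + p * ⟦ σ ⟧ (⟦ τ ⟧ f) k
        ≡⟨ act-* σ (+ p) (⟦ τ ⟧ f) k ⟨
      ⟦ σ ⟧ (λ i → + p * ⟦ τ ⟧ f i) k
        ≡⟨ act-cong σ σf≡pτf k ⟨
      ⟦ σ ⟧ (⟦ σ ⟧ f) k
        ≡⟨ root k ⟩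
      + p * d * f k
        ≡⟨ ℤₚ.*-assoc (+ p) d (f k) ⟩
      + p * (d * f k) ∎)

  simple-prime∣ : ∀ {p} → Prime p → Coprime L p → ∀ M → ¬ p ∣ M → ∀ σ {f} → Periodic f →
                  SquareRoot σ (+ p * - + M) f → ∀ k → p ∣ ∣ f k ∣
  simple-prime∣ {p} pp cop M p∤M σ {f} per root k =
    fromMultiple (divide-root² pp cop σ (- + M) per root)
    where
    coprimePart : ∀ {x} y z → + p * x ≡ y * z → p ∣ ∣ y ∣ ℕ.* ∣ z ∣
    coprimePart {x} y z px≡yz = divides ∣ x ∣ (begin
      ∣ y ∣ ℕ.* ∣ z ∣    ≡⟨ ℤₚ.abs-* y z ⟨
      ∣ y * z ∣          ≡⟨ cong ∣_∣ px≡yz ⟨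
      ∣ + p * x ∣        ≡⟨ ℤₚ.abs-* (+ p) x ⟩
      p ℕ.* ∣ x ∣        ≡⟨ ℕₚ.*-comm p _ ⟩
      ∣ x ∣ ℕ.* p        ∎)
    fromMultiple : (∃[ τ ] ∀ i → + p * ⟦ τ ⟧ (⟦ τ ⟧ f) i ≡ - + M * f i) → p ∣ ∣ f k ∣
    fromMultiple (τ , pττf≡) = [ (λ p∣M → contradiction (subst (p ∣_) (ℤₚ.∣-i∣≡∣i∣ (+ M)) p∣M) p∤M) , (λ p∣f → p∣f) ]′
      (euclidsLemma ∣ - + M ∣ ∣ f k ∣ pp (coprimePart (- + M) (f k) (pττf≡ k)))

  -- If f = p g, then g is again a periodic root, so the divisibility hypothesis applies to g as
  -- well; this is why it ranges over all periodic roots. Only the value at the fixed index `k` has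
  -- to shrink, and `b` bounds it.
  infinite-descent : ∀ {p} → 1 < p → ∀ σ c →
    (∀ {f} → Periodic f → SquareRoot σ c f → ∀ k → p ∣ ∣ f k ∣) →
    ∀ b {f} → Periodic f → SquareRoot σ c f → ∀ k → ∣ f k ∣ ≤ b → f k ≡ + 0
  infinite-descent 1<p σ c div zero per root k ∣fk∣≤0 = ℤₚ.∣i∣≡0⇒i≡0 (ℕₚ.n≤0⇒n≡0 ∣fk∣≤0)
  infinite-descent {p} 1<p σ c div (suc b) {f} per root k ∣fk∣≤ =
    trans (f≡pg k) (trans (cong (+ p *_) (infinite-descent 1<p σ c div b g-per g-root k ∣gk∣≤b)) (ℤₚ.*-zeroʳ (+ p)))
    where
    instance
      p≢0 : NonZero p
      p≢0 = ℕ.>-nonZero (ℕₚ.<⇒≤ 1<p)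
    p∣f : ∀ i → + p ℤᵈ.∣ f i
    p∣f i = ℤᵈ.∣ᵤ⇒∣ (div per root i)
    g : Seq
    g i = ℤᵈ.quotient (p∣f i)
    f≡pg : ∀ i → f i ≡ + p * g i
    f≡pg i = trans (ℤᵈ._∣_.equality (p∣f i)) (ℤₚ.*-comm (g i) (+ p))
    g-per : Periodic g
    g-per i = ℤₚ.*-cancelˡ-≡ (+ p) _ _ (trans (sym (f≡pg _)) (trans (per i) (f≡pg i)))
    g-root : SquareRoot σ c g
    g-root i = ℤₚ.*-cancelˡ-≡ (+ p) _ _ (begin
      + p * ⟦ σ ⟧ (⟦ σ ⟧ g) i       ≡⟨ trans (act-cong σ (act-* σ (+ p) g) i) (act-* σ (+ p) (⟦ σ ⟧ g) i) ⟨
      ⟦ σ ⟧ (⟦ σ ⟧ (λ i → + p * g i)) i  ≡⟨ act-cong σ (act-cong σ f≡pg) i ⟨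
      ⟦ σ ⟧ (⟦ σ ⟧ f) i             ≡⟨ root i ⟩
      c * f i                       ≡⟨ cong (c *_) (f≡pg i) ⟩
      c * (+ p * g i)               ≡⟨ x∙yz≈y∙xz c (+ p) (g i) ⟩
      + p * (c * g i)               ∎)
    bound : ∀ x → p ℕ.* x ≤ suc b → x ≤ b
    bound zero _ = z≤n
    bound x@(suc _) px≤ = ℕₚ.≤-pred (ℕₚ.<-≤-trans (ℕₚ.m<m*n x p 1<p) (subst (_≤ suc b) (ℕₚ.*-comm p x) px≤))
    ∣gk∣≤b : ∣ g k ∣ ≤ b
    ∣gk∣≤b = bound ∣ g k ∣ (subst (_≤ suc b) (trans (cong ∣_∣ (f≡pg k)) (ℤₚ.abs-* (+ p) (g k))) ∣fk∣≤)

  -- Since N ≡ 3 (mod 4) is not a square, some prime divides it to an odd power; dividing out squares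
  -- of primes preserves N mod 4 and ends at a prime dividing N exactly once.
  square-root-zero : ∀ N → N % 4 ≡ 3 → Coprime L N → ∀ σ {f} → Periodic f → SquareRoot σ (- + N) f →
                     ∀ k → f k ≡ + 0
  square-root-zero = <-rec _ step
    where
    1< : ∀ N → N % 4 ≡ 3 → 1 < N
    1< (suc (suc N)) _ = s≤s (s≤s z≤n)
    -factor : ∀ {N M} p → N ≡ M ℕ.* p → - + N ≡ + p * - + M
    -factor {N} {M} p N≡ = begin
      - + N            ≡⟨ cong (λ x → - + x) (trans N≡ (ℕₚ.*-comm M p)) ⟩
      - + (p ℕ.* M)    ≡⟨ cong -_ (ℤₚ.pos-* p M) ⟩
      - (+ p * + M)    ≡⟨ ℤₚ.neg-distribʳ-* (+ p) (+ M) ⟩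
      + p * - + M      ∎
    step : ∀ N → (∀ {N′} → N′ < N → N′ % 4 ≡ 3 → Coprime L N′ → ∀ σ {f} → Periodic f →
                    SquareRoot σ (- + N′) f → ∀ k → f k ≡ + 0) →
           N % 4 ≡ 3 → Coprime L N → ∀ σ {f} → Periodic f → SquareRoot σ (- + N) f → ∀ k → f k ≡ + 0
    step N rec N≡3 cop σ {f} per root k =
      case primeDivisor N (1< N N≡3) of λ (p , pp , divides M N≡) → withPrime p pp M N≡
      where
      withPrime : ∀ p → Prime p → ∀ M → N ≡ M ℕ.* p → f k ≡ + 0
      withPrime p pp M N≡ = go (p ∣? M)
        where
        Np = divides M N≡
        copₚ : Coprime L p
        copₚ (d∣L , d∣p) = cop (d∣L , ℕᵈ.∣-trans d∣p Np)
        instance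
          p≢0 : NonZero p
          p≢0 = prime⇒nonZero pp
        1<p = ℕ.nonTrivial⇒n>1 p {{prime⇒nonTrivial pp}}
        root′ : ∀ {g} → SquareRoot σ (- + N) g → SquareRoot σ (+ p * - + M) g
        root′ r i = trans (r i) (cong (_* _) (-factor p N≡))
        go : Dec (p ∣ M) → f k ≡ + 0
        go (no p∤M) = infinite-descent 1<p σ (- + N)
          (λ per′ r → simple-prime∣ pp copₚ M p∤M σ per′ (root′ r)) ∣ f k ∣ per root k ℕₚ.≤-refl
        -- Here N = p² M′. Cancelling p in p τ² f = -p M′ f makes τ a root of -M′ on the same f, so
        -- the recursion changes the operator and keeps the sequence.
        go (yes (divides M′ M≡)) = case divide-root² pp copₚ σ (- + M) per (root′ root) of λ (τ , pττf≡) →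
          rec M′<N (square*≡3-mod-4 p M′ (subst (λ x → x % 4 ≡ 3) N≡p²M′ N≡3))
            (λ (d∣L , d∣M′) → cop (d∣L , ℕᵈ.∣-trans d∣M′ (ℕᵈ.∣-trans (divides p M≡pM′) (divides p N≡pM))))
            τ per
            (λ i → ℤₚ.*-cancelˡ-≡ (+ p) _ _ (trans (pττf≡ i)
              (trans (cong (_* f i) (-factor p M≡)) (ℤₚ.*-assoc (+ p) (- + M′) (f i)))))
            k
          where
          M≡pM′ : M ≡ p ℕ.* M′
          M≡pM′ = trans M≡ (ℕₚ.*-comm M′ p)
          N≡pM : N ≡ p ℕ.* M
          N≡pM = trans N≡ (ℕₚ.*-comm M p)
          N≡p²M′ : N ≡ p ℕ.* (p ℕ.* M′)
          N≡p²M′ = trans N≡pM (cong (p ℕ.*_) M≡pM′)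
          M′≢0 : M′ ≢ 0
          M′≢0 refl = ℕₚ.>⇒≢ (ℕₚ.<⇒≤ (1< N N≡3)) (trans N≡ (cong (ℕ._* p) M≡))
          M′<N : M′ < N
          M′<N = subst (M′ <_) (sym N≡)
            (ℕₚ.<-≤-trans (subst (M′ <_) (sym M≡) (ℕₚ.m<m*n M′ p {{ℕ.≢-nonZero M′≢0}} 1<p)) (ℕₚ.m≤m*n M p))

-- Negacirculant matrices as polynomials in the shift

neg*neg : ∀ x y → - x * - y ≡ x * y
neg*neg = solve-∀

-- Finite sums and scalar matrices

∑-cong : ∀ {n} {f g : Fin n → ℤ} → f ≗ g → ∑ f ≡ ∑ g
∑-cong {zero} f≗g = refl
∑-cong {suc n} f≗g = cong₂ _+_ (f≗g zero) (∑-cong (λ i → f≗g (suc i)))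

∑-zero : ∀ n → ∑ {n} (λ _ → + 0) ≡ + 0
∑-zero zero = refl
∑-zero (suc n) = trans (ℤₚ.+-identityˡ _) (∑-zero n)

∑-+ : ∀ {n} (f g : Fin n → ℤ) → ∑ (λ i → f i + g i) ≡ ∑ f + ∑ g
∑-+ {zero} f g = refl
∑-+ {suc n} f g = trans (cong (λ z → f zero + g zero + z) (∑-+ (λ i → f (suc i)) (λ i → g (suc i))))
                          (interchange (f zero) (g zero) _ _)

∑-*ˡ : ∀ {n} c (f : Fin n → ℤ) → ∑ (λ i → c * f i) ≡ c * ∑ f
∑-*ˡ {zero} c f = sym (ℤₚ.*-zeroʳ c)
∑-*ˡ {suc n} c f = trans (cong (λ z → c * f zero + z) (∑-*ˡ c (λ i → f (suc i)))) (sym (ℤₚ.*-distribˡ-+ c _ _))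

∑-*ʳ : ∀ {n} c (f : Fin n → ℤ) → ∑ (λ i → f i * c) ≡ ∑ f * c
∑-*ʳ c f = trans (∑-cong (λ i → ℤₚ.*-comm (f i) c)) (trans (∑-*ˡ c f) (ℤₚ.*-comm c (∑ f)))

∑-swap : ∀ {m n} (f : Fin m → Fin n → ℤ) → ∑ (λ i → ∑ (λ j → f i j)) ≡ ∑ (λ j → ∑ (λ i → f i j))
∑-swap {zero} {n} f = sym (∑-zero n)
∑-swap {suc m} f = trans (cong (λ z → ∑ (f zero) + z) (∑-swap (λ i → f (suc i))))
                         (sym (∑-+ (f zero) (λ j → ∑ (λ i → f (suc i) j))))

∑-init-last : ∀ {n} (f : Fin (suc n) → ℤ) → ∑ f ≡ ∑ (λ i → f (inject₁ i)) + f (fromℕ n)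
∑-init-last {zero} f = ℤₚ.+-comm (f zero) (+ 0)
∑-init-last {suc n} f = trans (cong (λ z → f zero + z) (∑-init-last (λ i → f (suc i)))) (sym (ℤₚ.+-assoc (f zero) _ _))

∑-opposite : ∀ {n} (f : Fin n → ℤ) → ∑ (λ i → f (opposite i)) ≡ ∑ f
∑-opposite {zero} f = refl
∑-opposite {suc n} f = begin
  f (fromℕ n) + ∑ (λ i → f (inject₁ (opposite i)))    ≡⟨ cong (λ z → f (fromℕ n) + z) (∑-opposite (λ i → f (inject₁ i))) ⟩
  f (fromℕ n) + ∑ (λ i → f (inject₁ i))               ≡⟨ ℤₚ.+-comm (f (fromℕ n)) _ ⟩
  ∑ (λ i → f (inject₁ i)) + f (fromℕ n)               ≡⟨ ∑-init-last f ⟨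
  ∑ f                                                 ∎

∑-multiple : ∀ c {n} {f : Fin n → ℤ} → (∀ i → ∃[ e ] f i ≡ c * e) → ∃[ e ] ∑ f ≡ c * e
∑-multiple c f≡ = ∑ (λ i → proj₁ (f≡ i)) , trans (∑-cong (λ i → proj₂ (f≡ i))) (∑-*ˡ c (λ i → proj₁ (f≡ i)))

∑-last : ∀ n (h : Seq) → ∑ {suc n} (λ i → h (toℕ i)) ≡ ∑ {n} (λ i → h (toℕ i)) + h n
∑-last n h = trans (∑-init-last {n} (λ i → h (toℕ i)))
  (cong₂ _+_ (∑-cong {n} (λ i → cong h (toℕ-inject₁ i))) (cong h (toℕ-fromℕ n)))

-- Sliding the window by one drops `h 0` and gains `h n`, which are equal. In `act-extend` this
-- aligns a sum over shifts with a row of the matrix.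
∑-rotate : ∀ n (h : Seq) → (∀ k → h (n ℕ.+ k) ≡ h k) →
           ∀ a → ∑ {n} (λ i → h (a ℕ.+ toℕ i)) ≡ ∑ {n} (λ i → h (toℕ i))
∑-rotate n h per zero = refl
∑-rotate n h per (suc a) = begin
  ∑ {n} (λ i → h (suc (a ℕ.+ toℕ i)))
    ≡⟨ ∑-rotate n (λ k → h (suc k)) (λ k → trans (cong h (sym (ℕₚ.+-suc n k))) (per (suc k))) a ⟩
  ∑ {n} (λ i → h (suc (toℕ i)))
    ≡⟨ move (h 0) _ _ (trans (∑-last n h) (cong (λ z → ∑ {n} (λ i → h (toℕ i)) + z)
                                               (trans (cong h (sym (ℕₚ.+-identityʳ n))) (per 0)))) ⟩
  ∑ {n} (λ i → h (toℕ i)) ∎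
  where
  move : ∀ x y z → x + y ≡ z + x → y ≡ z
  move x y z e = ∙-cancelˡ x y z (trans e (ℤₚ.+-comm z x))

∑-split : ∀ m {n} (f : Fin (m ℕ.+ n) → ℤ) → ∑ f ≡ ∑ (λ i → f (i ↑ˡ n)) + ∑ (λ j → f (m ↑ʳ j))
∑-split zero f = sym (ℤₚ.+-identityˡ _)
∑-split (suc m) f = trans (cong (λ z → f zero + z) (∑-split m (λ i → f (suc i)))) (sym (ℤₚ.+-assoc (f zero) _ _))

∑-scalarId : ∀ {n} c i (d : Fin n → ℤ) → ∑ (λ j → scalarId c i j * d j) ≡ c * d i
∑-scalarId {suc n} c zero d =
  trans (cong (λ z → c * d zero + z) (trans (∑-cong {n} {g = λ _ → + 0} (λ _ → refl)) (∑-zero n))) (ℤₚ.+-identityʳ _)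
∑-scalarId {suc n} c (suc i) d = trans (ℤₚ.+-identityˡ _) (∑-scalarId c i (λ j → d (suc j)))

scalarId-diagonal : ∀ {n} c (i : Fin n) → scalarId c i i ≡ c
scalarId-diagonal c zero = refl
scalarId-diagonal c (suc i) = scalarId-diagonal c i

scalarId-↑ʳ : ∀ m {n} c (i j : Fin n) → scalarId c (m ↑ʳ i) (m ↑ʳ j) ≡ scalarId c i j
scalarId-↑ʳ zero c i j = refl
scalarId-↑ʳ (suc m) c i j = scalarId-↑ʳ m c i j

scalarId-↑ˡ-↑ʳ : ∀ {m n} c (i : Fin m) (j : Fin n) → scalarId c (i ↑ˡ n) (m ↑ʳ j) ≡ + 0
scalarId-↑ˡ-↑ʳ c zero j = refl
scalarId-↑ˡ-↑ʳ c (suc i) j = scalarId-↑ˡ-↑ʳ c i j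

infixr 7 _∙_
_∙_ : ∀ {n} → Matrix n → (Fin n → ℤ) → Fin n → ℤ
(M ∙ d) i = ∑ (λ j → M i j * d j)

at-toℕ : ∀ {n} (w : Fin n → ℤ) i → at w (toℕ i) ≡ w i
at-toℕ w zero = refl
at-toℕ w (suc i) = at-toℕ (λ j → w (suc j)) i

-- Antiperiodic sequences and the shift form of a negacirculant matrix

module _ {n : ℕ} .{{_ : NonZero n}} where

  Antiperiodic : Seq → Set
  Antiperiodic f = ∀ k → f (n ℕ.+ k) ≡ - f k

  -- The factor (-1)^(k / n) makes this the continuation of `d` that changes sign after n steps. On
  -- such sequences the plain shift acts as the negacyclic shift does on vectors.
  extend : (Fin n → ℤ) → Seq
  extend d k = sgn (k / n) * at d (k % n)

  extend-< : ∀ d {k} → k < n → extend d k ≡ at d k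
  extend-< d k<n = trans (cong₂ (λ a b → sgn a * at d b) (m<n⇒m/n≡0 k<n) (m<n⇒m%n≡m k<n)) (ℤₚ.*-identityˡ _)

  extend-toℕ : ∀ d i → extend d (toℕ i) ≡ d i
  extend-toℕ d i = trans (extend-< d (toℕ<n i)) (at-toℕ d i)

  extend-antiperiodic : ∀ d → Antiperiodic (extend d)
  extend-antiperiodic d k = begin
    sgn ((n ℕ.+ k) / n) * at d ((n ℕ.+ k) % n)
      ≡⟨ cong₂ (λ a b → sgn a * at d b)
           (trans (+-distrib-/-∣ˡ k ∣-refl) (cong (ℕ._+ k / n) (n/n≡1 n)))
           (trans (cong (_% n) (ℕₚ.+-comm n k)) ([m+n]%n≡m%n k n)) ⟩
    - sgn (k / n) * at d (k % n)
      ≡⟨ ℤₚ.neg-distribˡ-* (sgn (k / n)) _ ⟨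
    - (sgn (k / n) * at d (k % n)) ∎

  act-antiperiodic : ∀ A {f} → Antiperiodic f → Antiperiodic (⟦ A ⟧ f)
  act-antiperiodic A {f} anti k = begin
    ⟦ A ⟧ f (n ℕ.+ k)              ≡⟨ act-shift A n f k ⟨
    ⟦ A ⟧ (λ i → f (n ℕ.+ i)) k    ≡⟨ act-cong A (λ i → trans (anti i) (sym (ℤₚ.-1*i≡-i (f i)))) k ⟩
    ⟦ A ⟧ (λ i → - + 1 * f i) k    ≡⟨ act-* A (- + 1) f k ⟩
    - + 1 * ⟦ A ⟧ f k              ≡⟨ ℤₚ.-1*i≡-i _ ⟩
    - ⟦ A ⟧ f k                    ∎

  antiperiodic-≗ : ∀ {f g} → Antiperiodic f → Antiperiodic g →
                   (∀ i → f (toℕ {n} i) ≡ g (toℕ i)) → f ≗ g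
  antiperiodic-≗ {f} {g} f-anti g-anti agreed k = begin
    f k                            ≡⟨ cong f k≡ ⟩
    f (k / n ℕ.* n ℕ.+ k % n)      ≡⟨ along (k / n) ⟩
    g (k / n ℕ.* n ℕ.+ k % n)      ≡⟨ cong g k≡ ⟨
    g k                            ∎
    where
    k≡ : k ≡ k / n ℕ.* n ℕ.+ k % n
    k≡ = trans (m≡m%n+[m/n]*n k n) (ℕₚ.+-comm (k % n) _)
    along : ∀ m → f (m ℕ.* n ℕ.+ k % n) ≡ g (m ℕ.* n ℕ.+ k % n)
    along zero = begin
      f (k % n)  ≡⟨ cong f (toℕ-fromℕ< (m%n<n k n)) ⟨
      f (toℕ (fromℕ< (m%n<n k n)))  ≡⟨ agreed _ ⟩
      g (toℕ (fromℕ< (m%n<n k n)))  ≡⟨ cong g (toℕ-fromℕ< (m%n<n k n)) ⟩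
      g (k % n)  ∎
    along (suc m) = begin
      f (n ℕ.+ m ℕ.* n ℕ.+ k % n)    ≡⟨ cong f (ℕₚ.+-assoc n _ _) ⟩
      f (n ℕ.+ (m ℕ.* n ℕ.+ k % n))  ≡⟨ f-anti _ ⟩
      - f (m ℕ.* n ℕ.+ k % n)        ≡⟨ cong -_ (along m) ⟩
      - g (m ℕ.* n ℕ.+ k % n)        ≡⟨ g-anti _ ⟨
      g (n ℕ.+ (m ℕ.* n ℕ.+ k % n))  ≡⟨ cong g (ℕₚ.+-assoc n _ _) ⟨
      g (n ℕ.+ m ℕ.* n ℕ.+ k % n)    ∎

poly : ∀ {n} → (Fin n → ℤ) → ShiftPoly
poly {zero} w = const (+ 0)
poly {suc n} w = const (w zero) ⊞ shift ⊠ poly (λ i → w (suc i))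

act-poly : ∀ {n} (w : Fin n → ℤ) f k → ⟦ poly w ⟧ f k ≡ ∑ (λ i → w i * f (toℕ i ℕ.+ k))
act-poly {zero} w f k = refl
act-poly {suc n} w f k = cong (λ z → w zero * f k + z)
  (trans (act-poly (λ i → w (suc i)) f (suc k))
         (∑-cong (λ i → cong (λ m → w (suc i) * f m) (ℕₚ.+-suc (toℕ i) k))))

module _ {n : ℕ} .{{_ : NonZero n}} {M : Matrix n} (neg : IsNegacirculant n M) where
  private
    w = proj₁ neg
    W = extend w

  -- Both sides of the diagonal show the antiperiodic W at j - i. Adding n keeps the index natural
  -- and costs the sign, which merges the two cases of the definition.
  negacirculant-entry : ∀ i j → M i j ≡ - W (n ℕ.∸ toℕ i ℕ.+ toℕ j)
  negacirculant-entry i j = trans (proj₂ neg i j) (cases (toℕ i ≤ᵇ toℕ j) refl)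
    where
    i≤n = ℕₚ.<⇒≤ (toℕ<n i)
    cases : ∀ b → (toℕ i ≤ᵇ toℕ j) ≡ b →
            (if b then at w (toℕ j ℕ.∸ toℕ i) else - at w ((n ℕ.+ toℕ j) ℕ.∸ toℕ i))
              ≡ - W (n ℕ.∸ toℕ i ℕ.+ toℕ j)
    cases true e = begin
      at w (toℕ j ℕ.∸ toℕ i)
        ≡⟨ extend-< w (ℕₚ.≤-<-trans (ℕₚ.m∸n≤m (toℕ j) (toℕ i)) (toℕ<n j)) ⟨
      W (toℕ j ℕ.∸ toℕ i)
        ≡⟨ ℤₚ.neg-involutive _ ⟨
      - - W (toℕ j ℕ.∸ toℕ i)
        ≡⟨ cong -_ (extend-antiperiodic w _) ⟨
      - W (n ℕ.+ (toℕ j ℕ.∸ toℕ i))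
        ≡⟨ cong (λ m → - W m) (trans (sym (ℕₚ.+-∸-assoc n i≤j)) (ℕₚ.+-∸-comm (toℕ j) i≤n)) ⟩
      - W (n ℕ.∸ toℕ i ℕ.+ toℕ j) ∎
      where
      i≤j : toℕ i ≤ toℕ j
      i≤j = ℕₚ.≤ᵇ⇒≤ _ _ (subst T (sym e) _)
    cases false e = cong -_ (begin
      at w ((n ℕ.+ toℕ j) ℕ.∸ toℕ i)   ≡⟨ cong (at w) comm ⟩
      at w (n ℕ.∸ toℕ i ℕ.+ toℕ j)     ≡⟨ extend-< w below ⟨
      W (n ℕ.∸ toℕ i ℕ.+ toℕ j)        ∎)
      where
      comm = ℕₚ.+-∸-comm {n} (toℕ j) {toℕ i} i≤n
      j<i : toℕ j < toℕ i
      j<i = ℕₚ.≰⇒> (λ i≤j → subst T e (ℕₚ.≤⇒≤ᵇ i≤j))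
      below : n ℕ.∸ toℕ i ℕ.+ toℕ j < n
      below = subst (n ℕ.∸ toℕ i ℕ.+ toℕ j <_) (ℕₚ.m∸n+n≡m i≤n) (ℕₚ.+-monoʳ-< (n ℕ.∸ toℕ i) j<i)

  -- The summand W(k) D(k + i) is a product of two antiperiodic factors, hence n-periodic in k, and
  -- the sum may start at k = n - i. With k = n - i + j the argument of D becomes n + j; the sign
  -- this produces is the one that W(k) needs to become the entry of M.
  act-extend : ∀ d → ⟦ poly w ⟧ (extend d) ≗ extend (M ∙ d)
  act-extend d = antiperiodic-≗ (act-antiperiodic (poly w) (extend-antiperiodic d)) (extend-antiperiodic (M ∙ d)) λ i → begin
    ⟦ poly w ⟧ D (toℕ i)
      ≡⟨ act-poly w D (toℕ i) ⟩
    ∑ (λ k → w k * D (toℕ k ℕ.+ toℕ i))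
      ≡⟨ ∑-cong (λ k → cong (_* D (toℕ k ℕ.+ toℕ i)) (extend-toℕ w k)) ⟨
    ∑ {n} (λ k → h i (toℕ k))
      ≡⟨ ∑-rotate n (h i) (h-periodic i) (n ℕ.∸ toℕ i) ⟨
    ∑ {n} (λ j → h i (n ℕ.∸ toℕ i ℕ.+ toℕ j))
      ≡⟨ ∑-cong (λ j → entry i j) ⟩
    ∑ (λ j → M i j * d j)
      ≡⟨ extend-toℕ (M ∙ d) i ⟨
    extend (M ∙ d) (toℕ i) ∎
    where
    D = extend d
    h : Fin n → Seq
    h i k = W k * D (k ℕ.+ toℕ i)
    h-periodic : ∀ i k → h i (n ℕ.+ k) ≡ h i k
    h-periodic i k = trans
      (cong₂ _*_ (extend-antiperiodic w k) (trans (cong D (ℕₚ.+-assoc n k (toℕ i))) (extend-antiperiodic d (k ℕ.+ toℕ i))))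
      (neg*neg (W k) (D (k ℕ.+ toℕ i)))
    entry : ∀ i j → h i (n ℕ.∸ toℕ i ℕ.+ toℕ j) ≡ M i j * d j
    entry i j = begin
      W m * D (m ℕ.+ toℕ i)      ≡⟨ cong (λ k → W m * D k) position ⟩
      W m * D (n ℕ.+ toℕ j)      ≡⟨ cong (W m *_) (extend-antiperiodic d (toℕ j)) ⟩
      W m * - D (toℕ j)          ≡⟨ move (W m) (D (toℕ j)) ⟩
      - W m * D (toℕ j)          ≡⟨ cong₂ _*_ (sym (negacirculant-entry i j)) (extend-toℕ d j) ⟩
      M i j * d j                ∎
      where
      m = n ℕ.∸ toℕ i ℕ.+ toℕ j
      move : ∀ x y → x * - y ≡ - x * y
      move = solve-∀
      position : m ℕ.+ toℕ i ≡ n ℕ.+ toℕ j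
      position = begin
        n ℕ.∸ toℕ i ℕ.+ toℕ j ℕ.+ toℕ i      ≡⟨ ℕₚ.+-assoc (n ℕ.∸ toℕ i) _ _ ⟩
        n ℕ.∸ toℕ i ℕ.+ (toℕ j ℕ.+ toℕ i)    ≡⟨ cong (n ℕ.∸ toℕ i ℕ.+_) (ℕₚ.+-comm (toℕ j) _) ⟩
        n ℕ.∸ toℕ i ℕ.+ (toℕ i ℕ.+ toℕ j)    ≡⟨ ℕₚ.+-assoc (n ℕ.∸ toℕ i) _ _ ⟨
        n ℕ.∸ toℕ i ℕ.+ toℕ i ℕ.+ toℕ j      ≡⟨ cong (ℕ._+ toℕ j) (ℕₚ.m∸n+n≡m (ℕₚ.<⇒≤ (toℕ<n i))) ⟩
        n ℕ.+ toℕ j                          ∎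

  -- Entries depend only on j - i, and (n - 1 - i) - (n - 1 - j) is the same difference.
  negacirculant-opposite : ∀ i j → M (opposite j) (opposite i) ≡ M i j
  negacirculant-opposite i j = begin
    M (opposite j) (opposite i)
      ≡⟨ negacirculant-entry (opposite j) (opposite i) ⟩
    - W (n ℕ.∸ toℕ (opposite j) ℕ.+ toℕ (opposite i))
      ≡⟨ cong (λ m → - W m) position ⟩
    - W (n ℕ.∸ toℕ i ℕ.+ toℕ j)
      ≡⟨ negacirculant-entry i j ⟨
    M i j ∎
    where
    position : n ℕ.∸ toℕ (opposite j) ℕ.+ toℕ (opposite i) ≡ n ℕ.∸ toℕ i ℕ.+ toℕ j
    position = begin
      n ℕ.∸ toℕ (opposite j) ℕ.+ toℕ (opposite i)
        ≡⟨ cong₂ (λ a b → n ℕ.∸ a ℕ.+ b) (opposite-prop j) (opposite-prop i) ⟩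
      n ℕ.∸ (n ℕ.∸ suc (toℕ j)) ℕ.+ (n ℕ.∸ suc (toℕ i))
        ≡⟨ cong (ℕ._+ (n ℕ.∸ suc (toℕ i))) (ℕₚ.m∸[m∸n]≡n (toℕ<n j)) ⟩
      suc (toℕ j) ℕ.+ (n ℕ.∸ suc (toℕ i))
        ≡⟨ ℕₚ.+-∸-assoc (suc (toℕ j)) (toℕ<n i) ⟨
      suc (toℕ j) ℕ.+ n ℕ.∸ suc (toℕ i)
        ≡⟨ cong (ℕ._∸ toℕ i) (ℕₚ.+-comm (toℕ j) n) ⟩
      n ℕ.+ toℕ j ℕ.∸ toℕ i
        ≡⟨ ℕₚ.+-∸-comm (toℕ j) (ℕₚ.<⇒≤ (toℕ<n i)) ⟩
      n ℕ.∸ toℕ i ℕ.+ toℕ j ∎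

negacirculant-commute : ∀ {n} .{{_ : NonZero n}} {M N : Matrix n} → IsNegacirculant n M → IsNegacirculant n N →
                        ∀ d i → (M ∙ N ∙ d) i ≡ (N ∙ M ∙ d) i
negacirculant-commute {M = M} {N} neg neg′ d i = begin
  (M ∙ N ∙ d) i                                  ≡⟨ twice neg neg′ ⟨
  ⟦ poly w ⟧ (⟦ poly w′ ⟧ (extend d)) (toℕ i)    ≡⟨ act-comm (poly w) (poly w′) (extend d) (toℕ i) ⟩
  ⟦ poly w′ ⟧ (⟦ poly w ⟧ (extend d)) (toℕ i)    ≡⟨ twice neg′ neg ⟩
  (N ∙ M ∙ d) i                                  ∎
  where
  w = proj₁ neg
  w′ = proj₁ neg′
  twice : ∀ {A B} (a : IsNegacirculant _ A) (b : IsNegacirculant _ B) →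
          ⟦ poly (proj₁ a) ⟧ (⟦ poly (proj₁ b) ⟧ (extend d)) (toℕ i) ≡ (A ∙ B ∙ d) i
  twice {A} {B} a b = trans (act-cong (poly (proj₁ a)) (act-extend b d) (toℕ i))
    (trans (act-extend a (B ∙ d) (toℕ i)) (extend-toℕ (A ∙ B ∙ d) i))

transpose-∙-∙ : ∀ {n} (M : Matrix n) d i → (transpose M ∙ M ∙ d) i ≡ ((transpose M · M) ∙ d) i
transpose-∙-∙ M d i = begin
  ∑ (λ k → M k i * ∑ (λ j → M k j * d j))      ≡⟨ ∑-cong (λ k → ∑-*ˡ (M k i) (λ j → M k j * d j)) ⟨
  ∑ (λ k → ∑ (λ j → M k i * (M k j * d j)))    ≡⟨ ∑-swap (λ k j → M k i * (M k j * d j)) ⟩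
  ∑ (λ j → ∑ (λ k → M k i * (M k j * d j)))
    ≡⟨ ∑-cong (λ j → trans (∑-cong (λ k → sym (ℤₚ.*-assoc (M k i) (M k j) (d j)))) (∑-*ʳ (d j) (λ k → M k i * M k j))) ⟩
  ∑ (λ j → ∑ (λ k → M k i * M k j) * d j)      ∎

∙-⊕ : ∀ {n} (A B : Matrix n) d i → (A ∙ d) i + (B ∙ d) i ≡ ((A ⊕ B) ∙ d) i
∙-⊕ A B d i = trans (sym (∑-+ (λ j → A i j * d j) (λ j → B i j * d j)))
  (∑-cong (λ j → sym (ℤₚ.*-distribʳ-+ (d j) (A i j) (B i j))))

∙-scalarId : ∀ {n} {A : Matrix n} {c} → (∀ i j → A i j ≡ scalarId c i j) → ∀ d i → (A ∙ d) i ≡ c * d i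
∙-scalarId {c = c} A≡ d i = trans (∑-cong (λ j → cong (_* d j) (A≡ i j))) (∑-scalarId c i d)

antiperiodic⇒periodic : ∀ n .{{_ : NonZero n}} {f} → Antiperiodic {n} f → Periodicity.Periodic (n ℕ.+ n) f
antiperiodic⇒periodic n {f} anti k = begin
  f (n ℕ.+ n ℕ.+ k)     ≡⟨ cong f (ℕₚ.+-assoc n n k) ⟩
  f (n ℕ.+ (n ℕ.+ k))   ≡⟨ anti _ ⟩
  - f (n ℕ.+ k)         ≡⟨ cong -_ (anti k) ⟩
  - - f k               ≡⟨ ℤₚ.neg-involutive (f k) ⟩
  f k                   ∎

-- The kernel of Q

module _ {n : ℕ} .{{_ : NonZero n}} {Q R : Matrix n} (neg : IsNegacirculant n R)
         (skew : ∀ i j → (R ⊕ transpose R) i j ≡ scalarId (+ 2) i j)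
         (gram : ∀ i j → ((transpose Q · Q) ⊕ (transpose R · R)) i j ≡ scalarId (+ (n ℕ.+ n)) i j)
         (mod4 : (n ℕ.+ n ℕ.∸ 1) % 4 ≡ 3) where

  -- On the kernel of Q, the skew part R - I of R squares to 1 - 2n.
  kernel-trivial : ∀ d → (∀ i → (Q ∙ d) i ≡ + 0) → ∀ i → d i ≡ + 0
  kernel-trivial d Qd≡0 i = trans (sym (extend-toℕ d i))
    (square-root-zero n N mod4 coprime σ
      (antiperiodic⇒periodic n (extend-antiperiodic d)) root (toℕ i))
    where
    N = n ℕ.+ n ℕ.∸ 1
    L≡1+N : n ℕ.+ n ≡ suc N
    L≡1+N = sym (ℕₚ.m+[n∸m]≡n (ℕₚ.≤-trans (ℕ.>-nonZero⁻¹ n) (ℕₚ.m≤m+n n n)))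
    coprime : Coprime (n ℕ.+ n) N
    coprime {e} (e∣L , e∣N) = ℕᵈ.∣1⇒≡1 (ℕᵈ.∣m+n∣m⇒∣n (subst (e ℕᵈ.∣_) (trans L≡1+N (ℕₚ.+-comm 1 N)) e∣L) e∣N)
    y = R ∙ d
    RᵀR : ∀ i → (transpose R ∙ y) i ≡ + (n ℕ.+ n) * d i
    RᵀR i = begin
      (transpose R ∙ y) i
        ≡⟨ ℤₚ.+-identityˡ _ ⟨
      + 0 + (transpose R ∙ y) i
        ≡⟨ cong (_+ (transpose R ∙ y) i)
             (trans (∑-cong (λ k → trans (cong (Q k i *_) (Qd≡0 k)) (ℤₚ.*-zeroʳ (Q k i)))) (∑-zero n)) ⟨
      (transpose Q ∙ Q ∙ d) i + (transpose R ∙ R ∙ d) i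
        ≡⟨ cong₂ _+_ (transpose-∙-∙ Q d i) (transpose-∙-∙ R d i) ⟩
      ((transpose Q · Q) ∙ d) i + ((transpose R · R) ∙ d) i
        ≡⟨ ∙-⊕ (transpose Q · Q) (transpose R · R) d i ⟩
      (((transpose Q · Q) ⊕ (transpose R · R)) ∙ d) i
        ≡⟨ ∙-scalarId gram d i ⟩
      + (n ℕ.+ n) * d i ∎
    -- With y = R d this says R² d + RᵀR d = 2 R d, so (R - I)² d = d - RᵀR d = (1 - 2n) d. The
    -- transpose drops out, and only R itself has to be expressed through the shift.
    R+Rᵀ : ∀ i → (R ∙ y) i + (transpose R ∙ y) i ≡ + 2 * y i
    R+Rᵀ i = trans (∙-⊕ R (transpose R) y i) (∙-scalarId skew y i)
    r = poly (proj₁ neg)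
    σ = r ⊞ const (- + 1)
    D = extend d
    expand : ∀ k → ⟦ σ ⟧ (⟦ σ ⟧ D) k ≡ ⟦ r ⟧ (⟦ r ⟧ D) k + - + 1 * ⟦ r ⟧ D k + - + 1 * (⟦ r ⟧ D k + - + 1 * D k)
    expand k = cong (_+ - + 1 * (⟦ r ⟧ D k + - + 1 * D k))
      (trans (act-+ r (⟦ r ⟧ D) (λ j → - + 1 * D j) k) (cong (λ z → ⟦ r ⟧ (⟦ r ⟧ D) k + z) (act-* r (- + 1) D k)))
    root : SquareRoot n σ (- + N) D
    root = antiperiodic-≗ (act-antiperiodic σ (act-antiperiodic σ (extend-antiperiodic d)))
      (λ k → trans (cong (- + N *_) (extend-antiperiodic d k)) (sym (ℤₚ.neg-distribʳ-* (- + N) (D k)))) λ i → begin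
      ⟦ σ ⟧ (⟦ σ ⟧ D) (toℕ i)
        ≡⟨ expand (toℕ i) ⟩
      ⟦ r ⟧ (⟦ r ⟧ D) (toℕ i) + - + 1 * ⟦ r ⟧ D (toℕ i) + - + 1 * (⟦ r ⟧ D (toℕ i) + - + 1 * D (toℕ i))
        ≡⟨ cong₂ (λ a b → a + - + 1 * b + - + 1 * (b + - + 1 * D (toℕ i)))
             (trans (act-cong r (act-extend neg d) (toℕ i)) (trans (act-extend neg y (toℕ i)) (extend-toℕ (R ∙ y) i)))
             (trans (act-extend neg d (toℕ i)) (extend-toℕ y i)) ⟩
      (R ∙ y) i + - + 1 * y i + - + 1 * (y i + - + 1 * D (toℕ i))
        ≡⟨ cong (λ b → (R ∙ y) i + - + 1 * y i + - + 1 * (y i + - + 1 * b)) (extend-toℕ d i) ⟩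
      (R ∙ y) i + - + 1 * y i + - + 1 * (y i + - + 1 * d i)
        ≡⟨ solveR ((R ∙ y) i) ((transpose R ∙ y) i) (y i) (d i) (R+Rᵀ i)
             (trans (RᵀR i) (cong (λ m → + m * d i) L≡1+N)) ⟩
      - + N * d i
        ≡⟨ cong (- + N *_) (extend-toℕ d i) ⟨
      - + N * D (toℕ i) ∎
      where
      solveR : ∀ a b y d → a + b ≡ + 2 * y → b ≡ (+ 1 + + N) * d →
               a + - + 1 * y + - + 1 * (y + - + 1 * d) ≡ - + N * d
      solveR a b y d a+b≡ b≡ = begin
        a + - + 1 * y + - + 1 * (y + - + 1 * d)      ≡⟨ rearrange a b y d ⟩
        (a + b) + - (+ 2 * y) + (d + - b)            ≡⟨ cong₂ (λ s t → s + - (+ 2 * y) + (d + - t)) a+b≡ b≡ ⟩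
        + 2 * y + - (+ 2 * y) + (d + - ((+ 1 + + N) * d))   ≡⟨ final y d (+ N) ⟩
        - + N * d                                    ∎
        where
        rearrange : ∀ a b y d → a + - + 1 * y + - + 1 * (y + - + 1 * d) ≡ (a + b) + - (+ 2 * y) + (d + - b)
        rearrange = solve-∀
        final : ∀ y d N → + 2 * y + - (+ 2 * y) + (d + - ((+ 1 + N) * d)) ≡ - N * d
        final = solve-∀

-- Singular matrices have dependent rows

minor : ∀ {m} → Matrix (suc m) → Fin (suc m) → Matrix m
minor M j r c = M (suc r) (punchIn j c)

laplaceTerm : ∀ {m} → Matrix (suc m) → Fin (suc m) → ℤ
laplaceTerm M j = sgn (toℕ j) * (M zero j * det (minor M j))

det-cong : ∀ {m} {M N : Matrix m} → (∀ i j → M i j ≡ N i j) → det M ≡ det N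
det-cong {zero} M≡N = refl
det-cong {suc m} M≡N = ∑-cong λ j →
  cong (sgn (toℕ j) *_) (cong₂ _*_ (M≡N zero j) (det-cong λ r c → M≡N (suc r) (punchIn j c)))

-- In the expansion along the first row, the term of column `c` is linear through its entry, since
-- its minor omits that column; every other term is linear through its minor, by recursion.
det-linear : ∀ {m} (c : Fin m) a b {A B M : Matrix m} →
             (∀ r → M r c ≡ a * A r c + b * B r c) →
             (∀ r j → j ≢ c → M r j ≡ A r j) → (∀ r j → j ≢ c → M r j ≡ B r j) →
             det M ≡ a * det A + b * det B
det-linear {suc m} c a b {A} {B} {M} Mc M≡A M≡B = begin
  ∑ (laplaceTerm M)
    ≡⟨ ∑-cong (λ j → term j (j ≟ c)) ⟩
  ∑ (λ j → a * laplaceTerm A j + b * laplaceTerm B j)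
    ≡⟨ ∑-+ (λ j → a * laplaceTerm A j) (λ j → b * laplaceTerm B j) ⟩
  ∑ (λ j → a * laplaceTerm A j) + ∑ (λ j → b * laplaceTerm B j)
    ≡⟨ cong₂ _+_ (∑-*ˡ a (laplaceTerm A)) (∑-*ˡ b (laplaceTerm B)) ⟩
  a * det A + b * det B ∎
  where
  term : ∀ j → Dec (j ≡ c) → laplaceTerm M j
       ≡ a * laplaceTerm A j + b * laplaceTerm B j
  term j (yes refl) = begin
    laplaceTerm M j
      ≡⟨ cong (λ z → sgn (toℕ j) * (z * det (minor M j))) (Mc zero) ⟩
    sgn (toℕ j) * ((a * A zero j + b * B zero j) * det (minor M j))
      ≡⟨ distribute (sgn (toℕ j)) a b (A zero j) (B zero j) (det (minor M j)) ⟩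
    a * (sgn (toℕ j) * (A zero j * det (minor M j))) + b * (sgn (toℕ j) * (B zero j * det (minor M j)))
      ≡⟨ cong₂ (λ x y → a * (sgn (toℕ j) * (A zero j * x)) + b * (sgn (toℕ j) * (B zero j * y)))
           (det-cong λ r k → M≡A (suc r) _ (punchInᵢ≢i j k)) (det-cong λ r k → M≡B (suc r) _ (punchInᵢ≢i j k)) ⟩
    a * laplaceTerm A j + b * laplaceTerm B j ∎
    where
    distribute : ∀ s a b x y d → s * ((a * x + b * y) * d) ≡ a * (s * (x * d)) + b * (s * (y * d))
    distribute = solve-∀
  term j (no j≢c) = begin
    laplaceTerm M j
      ≡⟨ cong (λ z → sgn (toℕ j) * (M zero j * z))
           (det-linear c′ a b Mc′ (λ r k k≢ → M≡A (suc r) _ (away k k≢)) (λ r k k≢ → M≡B (suc r) _ (away k k≢))) ⟩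
    sgn (toℕ j) * (M zero j * (a * det (minor A j) + b * det (minor B j)))
      ≡⟨ distribute (sgn (toℕ j)) (M zero j) a b (det (minor A j)) (det (minor B j)) ⟩
    a * (sgn (toℕ j) * (M zero j * det (minor A j))) + b * (sgn (toℕ j) * (M zero j * det (minor B j)))
      ≡⟨ cong₂ (λ x y → a * (sgn (toℕ j) * (x * det (minor A j))) + b * (sgn (toℕ j) * (y * det (minor B j))))
           (M≡A zero j j≢c) (M≡B zero j j≢c) ⟩
    a * laplaceTerm A j + b * laplaceTerm B j ∎
    where
    c′ = punchOut j≢c
    Mc′ : ∀ r → minor M j r c′ ≡ a * minor A j r c′ + b * minor B j r c′
    Mc′ r = subst (λ k → M (suc r) k ≡ a * A (suc r) k + b * B (suc r) k) (sym (punchIn-punchOut j≢c)) (Mc (suc r))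
    away : ∀ k → k ≢ c′ → punchIn j k ≢ c
    away k k≢c′ e = k≢c′ (punchIn-injective j k c′ (trans e (sym (punchIn-punchOut j≢c))))
    distribute : ∀ s x a b d e → s * (x * (a * d + b * e)) ≡ a * (s * (x * d)) + b * (s * (x * e))
    distribute = solve-∀

∑-pair : ∀ {m} (k : Fin m) {f g : Fin (suc m) → ℤ} →
         (∀ j → j ≢ inject₁ k → j ≢ suc k → f j ≡ g j) →
         f (inject₁ k) + f (suc k) ≡ g (inject₁ k) + g (suc k) → ∑ f ≡ ∑ g
∑-pair {suc m} zero {f} {g} f≡g pair = begin
  f zero + (f (suc zero) + ∑ (λ i → f (suc (suc i))))   ≡⟨ ℤₚ.+-assoc (f zero) _ _ ⟨
  f zero + f (suc zero) + ∑ (λ i → f (suc (suc i)))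
    ≡⟨ cong₂ _+_ pair (∑-cong (λ i → f≡g (suc (suc i)) (λ ()) (λ ()))) ⟩
  g zero + g (suc zero) + ∑ (λ i → g (suc (suc i)))     ≡⟨ ℤₚ.+-assoc (g zero) _ _ ⟩
  g zero + (g (suc zero) + ∑ (λ i → g (suc (suc i))))   ∎
∑-pair {suc m} (suc k) {f} {g} f≡g pair = cong₂ _+_ (f≡g zero (λ ()) (λ ()))
  (∑-pair k (λ j j≢ j≢′ → f≡g (suc j) (j≢ ∘ suc-injective) (j≢′ ∘ suc-injective)) pair)

-- Adjacency survives the deletion of a third column. For this reason the elimination works on
-- neighbouring columns only: `det-columnStep` can then recurse into minors.
punchIn-adjacent : ∀ {m} (j : Fin (suc (suc m))) (k : Fin (suc m)) → j ≢ inject₁ k → j ≢ suc k →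
                   ∃[ l ] punchIn j (inject₁ l) ≡ inject₁ k × punchIn j (suc l) ≡ suc k
punchIn-adjacent zero zero j≢k _ = contradiction refl j≢k
punchIn-adjacent zero (suc k) _ _ = k , refl , refl
punchIn-adjacent (suc zero) zero _ j≢k+1 = contradiction refl j≢k+1
punchIn-adjacent {suc m} (suc (suc j)) zero _ _ = zero , refl , refl
punchIn-adjacent {suc m} (suc j) (suc k) j≢ j≢′
  with l , e , e′ ← punchIn-adjacent j k (j≢ ∘ cong suc) (j≢′ ∘ cong suc) = suc l , cong suc e , cong suc e′

punchIn-inject₁ : ∀ {m} (k : Fin m) → punchIn (inject₁ k) k ≡ suc k
punchIn-inject₁ zero = refl
punchIn-inject₁ (suc k) = cong suc (punchIn-inject₁ k)

punchIn-suc : ∀ {m} (k : Fin m) → punchIn (suc k) k ≡ inject₁ k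
punchIn-suc zero = refl
punchIn-suc (suc k) = cong suc (punchIn-suc k)

punchIn-inject₁≡punchIn-suc : ∀ {m} (k c : Fin m) → c ≢ k → punchIn (inject₁ k) c ≡ punchIn (suc k) c
punchIn-inject₁≡punchIn-suc zero zero c≢k = contradiction refl c≢k
punchIn-inject₁≡punchIn-suc zero (suc c) _ = refl
punchIn-inject₁≡punchIn-suc (suc k) zero _ = refl
punchIn-inject₁≡punchIn-suc (suc k) (suc c) c≢k = cong suc (punchIn-inject₁≡punchIn-suc k c (c≢k ∘ cong suc))

-- The two columns are multiplied on the right by the block with rows (0, b) and (1, a), whose
-- determinant is -b. It combines elimination with a swap and avoids division, so matrices stay
-- integral and b ≠ 0 alone makes the step reversible over ℚ.
record ColumnStep {m} (k : Fin m) (a b : ℤ) (M N : Matrix (suc m)) : Set where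
  field
    left  : ∀ r → N r (inject₁ k) ≡ M r (suc k)
    right : ∀ r → N r (suc k) ≡ b * M r (inject₁ k) + a * M r (suc k)
    other : ∀ r j → j ≢ inject₁ k → j ≢ suc k → N r j ≡ M r j

-- Columns outside the pair contribute by recursion on their minors. In the remaining two terms the
-- minors trade places up to the factor b, and the parts with a cancel because neighbouring cofactor
-- signs are opposite.
det-columnStep : ∀ {m} (k : Fin m) {a b M N} → ColumnStep k a b M N → det N ≡ - b * det M
det-columnStep {suc m} k {a} {b} {M} {N} step =
  trans (∑-pair k other-term pair-term) (∑-*ˡ (- b) (laplaceTerm M))
  where
  open ColumnStep step
  p = inject₁ k
  q = suc k
  other-term : ∀ j → j ≢ p → j ≢ q →
    laplaceTerm N j ≡ - b * laplaceTerm M j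
  other-term j j≢p j≢q with l , l≡p , l+1≡q ← punchIn-adjacent j k j≢p j≢q = begin
    laplaceTerm N j
      ≡⟨ cong₂ (λ x d → sgn (toℕ j) * (x * d)) (other zero j j≢p j≢q) (det-columnStep l minorStep) ⟩
    sgn (toℕ j) * (M zero j * (- b * det (minor M j)))
      ≡⟨ pull (sgn (toℕ j)) (M zero j) (- b) (det (minor M j)) ⟩
    - b * laplaceTerm M j ∎
    where
    pull : ∀ s x b d → s * (x * (b * d)) ≡ b * (s * (x * d))
    pull = solve-∀
    away : ∀ {c d e} → punchIn j d ≡ e → c ≢ d → punchIn j c ≢ e
    away {c} {d} d≡ c≢d c≡ = c≢d (punchIn-injective j c d (trans c≡ (sym d≡)))
    minorStep : ColumnStep l a b (minor M j) (minor N j)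
    minorStep = record
      { left = λ r → trans (cong (N (suc r)) l≡p) (trans (left (suc r)) (cong (M (suc r)) (sym l+1≡q)))
      ; right = λ r → trans (cong (N (suc r)) l+1≡q) (trans (right (suc r))
          (cong₂ (λ x y → b * M (suc r) x + a * M (suc r) y) (sym l≡p) (sym l+1≡q)))
      ; other = λ r c c≢l c≢l+1 → other (suc r) _ (away l≡p c≢l) (away l+1≡q c≢l+1)
      }
  minor-q : det (minor N q) ≡ det (minor M p)
  minor-q = det-cong λ r c → entry r c (c ≟ k)
    where
    entry : ∀ r c → Dec (c ≡ k) → minor N q r c ≡ minor M p r c
    entry r c (yes refl) = trans (cong (N (suc r)) (punchIn-suc k))
      (trans (left (suc r)) (cong (M (suc r)) (sym (punchIn-inject₁ k))))
    entry r c (no c≢k) = trans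
      (other (suc r) _ (λ e → punchInᵢ≢i p c (trans (punchIn-inject₁≡punchIn-suc k c c≢k) e)) (punchInᵢ≢i q c))
      (cong (M (suc r)) (sym (punchIn-inject₁≡punchIn-suc k c c≢k)))
  minor-p : det (minor N p) ≡ b * det (minor M q) + a * det (minor M p)
  minor-p = det-linear k b a
    (λ r → trans (cong (N (suc r)) (punchIn-inject₁ k)) (trans (right (suc r))
      (cong₂ (λ x y → b * M (suc r) x + a * M (suc r) y) (sym (punchIn-suc k)) (sym (punchIn-inject₁ k)))))
    (λ r c c≢k → trans (away r c c≢k) (cong (M (suc r)) (punchIn-inject₁≡punchIn-suc k c c≢k)))
    away
    where
    away : ∀ r c → c ≢ k → minor N p r c ≡ minor M p r c
    away r c c≢k = other (suc r) _ (punchInᵢ≢i p c)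
      (λ e → punchInᵢ≢i q c (trans (sym (punchIn-inject₁≡punchIn-suc k c c≢k)) e))
  pair-term : laplaceTerm N p + laplaceTerm N q
            ≡ - b * laplaceTerm M p + - b * laplaceTerm M q
  pair-term rewrite toℕ-inject₁ k | minor-p | minor-q | left zero | right zero =
    identity (sgn (toℕ k)) (M zero p) (M zero q) a b (det (minor M p)) (det (minor M q))
    where
    identity : ∀ s x y a b d e → s * (y * (b * e + a * d)) + - s * ((b * x + a * y) * d)
                               ≡ - b * (s * (x * d)) + - b * (- s * (y * e))
    identity = solve-∀

-- A relation among rows is chosen because column operations do not alter it: `columnStep-dependent`
-- returns the very same `u`.
RowDependent : ∀ {m} → Matrix m → Set
RowDependent {m} M = Σ[ u ∈ (Fin m → ℤ) ] (∃[ i ] u i ≢ + 0) × (∀ j → ∑ (λ i → u i * M i j) ≡ + 0)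

columnStep : ∀ {m} (k : Fin m) (a b : ℤ) → Matrix (suc m) → Matrix (suc m)
columnStep k a b M r j with j ≟ inject₁ k | j ≟ suc k
... | yes _ | _     = M r (suc k)
... | no _  | yes _ = b * M r (inject₁ k) + a * M r (suc k)
... | no _  | no _  = M r j

inject₁≢suc : ∀ {m} (k : Fin m) → suc k ≢ inject₁ k
inject₁≢suc k e = ℕₚ.1+n≢n (trans (cong toℕ e) (toℕ-inject₁ k))

columnStep-correct : ∀ {m} (k : Fin m) a b M → ColumnStep k a b M (columnStep k a b M)
columnStep-correct k a b M = record { left = left ; right = right ; other = other }
  where
  left : ∀ r → columnStep k a b M r (inject₁ k) ≡ M r (suc k)
  left r with inject₁ k ≟ inject₁ k
  ... | yes _ = refl
  ... | no ne = contradiction refl ne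
  right : ∀ r → columnStep k a b M r (suc k) ≡ b * M r (inject₁ k) + a * M r (suc k)
  right r with suc k ≟ inject₁ k | suc k ≟ suc k
  ... | yes e | _    = contradiction e (inject₁≢suc k)
  ... | no _ | yes _ = refl
  ... | no _ | no ne = contradiction refl ne
  other : ∀ r j → j ≢ inject₁ k → j ≢ suc k → columnStep k a b M r j ≡ M r j
  other r j j≢p j≢q with j ≟ inject₁ k | j ≟ suc k
  ... | yes e | _     = contradiction e j≢p
  ... | no _  | yes e = contradiction e j≢q
  ... | no _  | no _  = refl

*-cancel-zero : ∀ {a x} → a ≢ + 0 → a * x ≡ + 0 → x ≡ + 0
*-cancel-zero {a} a≢0 ax≡0 = [ (λ a≡0 → contradiction a≡0 a≢0) , (λ x≡0 → x≡0) ]′ (ℤₚ.i*j≡0⇒i≡0∨j≡0 a ax≡0)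

columnStep-dependent : ∀ {m} (k : Fin m) {a b M N} → ColumnStep k a b M N → b ≢ + 0 → RowDependent N → RowDependent M
columnStep-dependent k {a} {b} {M} {N} step b≢0 (u , u≢0 , uN≡0) = u , u≢0 , λ j → column j (j ≟ inject₁ k) (j ≟ suc k)
  where
  open ColumnStep step
  p = inject₁ k
  q = suc k
  uMq : ∑ (λ i → u i * M i q) ≡ + 0
  uMq = trans (∑-cong (λ i → cong (u i *_) (sym (left i)))) (uN≡0 p)
  uMp : b * ∑ (λ i → u i * M i p) ≡ + 0
  uMp = begin
    b * ∑ (λ i → u i * M i p)
      ≡⟨ ℤₚ.+-identityʳ _ ⟨
    b * ∑ (λ i → u i * M i p) + + 0
      ≡⟨ cong (λ z → b * ∑ (λ i → u i * M i p) + z) (trans (cong (a *_) uMq) (ℤₚ.*-zeroʳ a)) ⟨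
    b * ∑ (λ i → u i * M i p) + a * ∑ (λ i → u i * M i q)
      ≡⟨ cong₂ _+_ (∑-*ˡ b (λ i → u i * M i p)) (∑-*ˡ a (λ i → u i * M i q)) ⟨
    ∑ (λ i → b * (u i * M i p)) + ∑ (λ i → a * (u i * M i q))
      ≡⟨ ∑-+ (λ i → b * (u i * M i p)) (λ i → a * (u i * M i q)) ⟨
    ∑ (λ i → b * (u i * M i p) + a * (u i * M i q))
      ≡⟨ ∑-cong (λ i → trans (regroup a b (u i) (M i p) (M i q)) (cong (u i *_) (sym (right i)))) ⟩
    ∑ (λ i → u i * N i q)
      ≡⟨ uN≡0 q ⟩
    + 0 ∎
    where
    regroup : ∀ a b u x y → b * (u * x) + a * (u * y) ≡ u * (b * x + a * y)
    regroup = solve-∀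
  column : ∀ j → Dec (j ≡ p) → Dec (j ≡ q) → ∑ (λ i → u i * M i j) ≡ + 0
  column j (yes refl) _ = *-cancel-zero b≢0 uMp
  column j (no _) (yes refl) = uMq
  column j (no j≢p) (no j≢q) = trans (∑-cong (λ i → cong (u i *_) (sym (other i j j≢p j≢q)))) (uN≡0 j)

-- Operations of nonzero determinant on adjacent columns keep row dependence and clear the first row
-- from the right, so that the determinant is a corner entry times the complementary minor.
singular⇒rowDependent : ∀ {m} (M : Matrix m) → det M ≡ + 0 → RowDependent M
clearFirstRow : ∀ {m} c → c ≤ m → (M : Matrix (suc m)) → (∀ j → c < toℕ j → M zero j ≡ + 0) →
                det M ≡ + 0 → RowDependent M

singular⇒rowDependent {zero} M ()
singular⇒rowDependent {suc m} M = clearFirstRow m ℕₚ.≤-refl M (λ j m<j → contradiction (toℕ<n j) (ℕₚ.<⇒≱ (s≤s m<j)))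

clearFirstRow {m} zero _ M M₀≡0 det≡0 = pivot (M zero zero ℤ.≟ + 0)
  where
  det≡ : det M ≡ M zero zero * det (minor M zero)
  det≡ = trans (cong₂ _+_ (ℤₚ.*-identityˡ (M zero zero * det (minor M zero)))
    (trans (∑-cong (λ j → trans (cong (λ x → sgn (suc (toℕ j)) * (x * det (minor M (suc j)))) (M₀≡0 (suc j) (s≤s z≤n)))
                                (ℤₚ.*-zeroʳ (sgn (suc (toℕ j)))))) (∑-zero m)))
    (ℤₚ.+-identityʳ _)
  pivot : Dec (M zero zero ≡ + 0) → RowDependent M
  pivot (yes M₀₀≡0) = scalarId (+ 1) zero , (zero , λ ()) , λ j →
    trans (∑-scalarId (+ 1) zero (λ i → M i j)) (trans (ℤₚ.*-identityˡ _) (firstRow j))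
    where
    firstRow : ∀ j → M zero j ≡ + 0
    firstRow zero = M₀₀≡0
    firstRow (suc j) = M₀≡0 (suc j) (s≤s z≤n)
  pivot (no M₀₀≢0) with u , (i , uᵢ≢0) , uM≡0 ←
      singular⇒rowDependent (minor M zero) (*-cancel-zero M₀₀≢0 (trans (sym det≡) det≡0))
    = v , (suc i , λ e → uᵢ≢0 (*-cancel-zero M₀₀≢0 e)) , vM≡0
    where
    a = M zero zero
    -- The first row is zero apart from its corner a. Scaling u by a lets a multiple of that row
    -- cancel column zero without division.
    v : Fin (suc m) → ℤ
    v zero = - ∑ (λ i → u i * M (suc i) zero)
    v (suc i) = a * u i
    scaled : ∀ j → ∑ (λ i → a * u i * M (suc i) j) ≡ a * ∑ (λ i → u i * M (suc i) j)
    scaled j = trans (∑-cong (λ i → ℤₚ.*-assoc a (u i) (M (suc i) j))) (∑-*ˡ a (λ i → u i * M (suc i) j))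
    cancel : ∀ x a → - x * a + a * x ≡ + 0
    cancel = solve-∀
    vM≡0 : ∀ j → ∑ (λ i → v i * M i j) ≡ + 0
    vM≡0 zero = trans (cong (λ z → v zero * a + z) (scaled zero)) (cancel (∑ (λ i → u i * M (suc i) zero)) a)
    vM≡0 (suc j) = trans (cong₂ _+_ (trans (cong (v zero *_) (M₀≡0 (suc j) (s≤s z≤n))) (ℤₚ.*-zeroʳ (v zero)))
                                    (trans (scaled (suc j)) (trans (cong (a *_) (uM≡0 j)) (ℤₚ.*-zeroʳ a)))) refl
clearFirstRow {m} (suc c) c<m M M₀≡0 det≡0 = clear (b ℤ.≟ + 0)
  where
  -- Column `q` has index `suc c`, the last one whose first entry may be nonzero.
  k = fromℕ< c<m
  p = inject₁ k
  q = suc k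
  -- With these coefficients the new first entry of column `q` is b x - x b = 0, where x is the old
  -- first entry of column `p`.
  a = - M zero p
  b = M zero q
  toℕ-k : toℕ k ≡ c
  toℕ-k = toℕ-fromℕ< c<m
  beyond : ∀ {j} → c < toℕ j → j ≢ q → suc c < toℕ j
  beyond c<j j≢q = ℕₚ.≤∧≢⇒< c<j (λ e → j≢q (toℕ-injective (trans (sym e) (cong suc (sym toℕ-k)))))
  step = columnStep-correct k a b M
  open ColumnStep step
  clear : Dec (b ≡ + 0) → RowDependent M
  clear (yes b≡0) = clearFirstRow c (ℕₚ.<⇒≤ c<m) M (λ j c<j → zeroAt j c<j (j ≟ q)) det≡0
    where
    zeroAt : ∀ j → c < toℕ j → Dec (j ≡ q) → M zero j ≡ + 0
    zeroAt j _ (yes refl) = b≡0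
    zeroAt j c<j (no j≢q) = M₀≡0 j (beyond c<j j≢q)
  clear (no b≢0) = columnStep-dependent k step b≢0
    (clearFirstRow c (ℕₚ.<⇒≤ c<m) (columnStep k a b M) (λ j c<j → zeroAt j c<j (j ≟ q))
      (trans (det-columnStep k step) (trans (cong (- b *_) det≡0) (ℤₚ.*-zeroʳ (- b)))))
    where
    cancel : ∀ x y → y * x + - x * y ≡ + 0
    cancel = solve-∀
    zeroAt : ∀ j → c < toℕ j → Dec (j ≡ q) → columnStep k a b M zero j ≡ + 0
    zeroAt j _ (yes refl) = trans (right zero) (cancel (M zero p) b)
    zeroAt j c<j (no j≢q) = trans
      (other zero j (λ e → ℕₚ.<⇒≢ c<j (sym (trans (cong toℕ e) (trans (toℕ-inject₁ k) toℕ-k)))) j≢q)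
      (M₀≡0 j (beyond c<j j≢q))

-- The blocks of a skew Hadamard matrix

∙-basis : ∀ {n} (M : Matrix n) j i → (M ∙ scalarId (+ 1) j) i ≡ M i j
∙-basis M j i = trans (∑-cong λ k → ℤₚ.*-comm (M i k) (scalarId (+ 1) j k))
  (trans (∑-scalarId (+ 1) j (M i)) (ℤₚ.*-identityˡ (M i j)))

negacirculant-·-comm : ∀ {n} .{{_ : NonZero n}} {M N : Matrix n} → IsNegacirculant n M → IsNegacirculant n N →
                       ∀ i j → (M · N) i j ≡ (N · M) i j
negacirculant-·-comm {M = M} {N} neg neg′ i j = begin
  (M · N) i j                          ≡⟨ ∑-cong (λ k → cong (M i k *_) (∙-basis N j k)) ⟨
  (M ∙ N ∙ scalarId (+ 1) j) i         ≡⟨ negacirculant-commute neg neg′ (scalarId (+ 1) j) i ⟩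
  (N ∙ M ∙ scalarId (+ 1) j) i         ≡⟨ ∑-cong (λ k → cong (N i k *_) (∙-basis M j k)) ⟩
  (N · M) i j                          ∎

IsSign : ℤ → Set
IsSign x = (x ≡ + 1) ⊎ (x ≡ - + 1)

-- A sum of two signs is even, so both factors are.
sign-product : ∀ {a b c} → IsSign a → IsSign b → IsSign c → ∃[ e ] (a + b) * (a + c) ≡ + 4 * e
sign-product (inj₁ refl) (inj₁ refl) (inj₁ refl) = + 1 , refl
sign-product (inj₁ refl) (inj₁ refl) (inj₂ refl) = + 0 , refl
sign-product (inj₁ refl) (inj₂ refl) _ = + 0 , refl
sign-product (inj₂ refl) (inj₁ refl) _ = + 0 , refl
sign-product (inj₂ refl) (inj₂ refl) (inj₁ refl) = + 0 , refl
sign-product (inj₂ refl) (inj₂ refl) (inj₂ refl) = + 1 , refl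

sign-double : ∀ {a} → IsSign a → a + a ≡ + 2 → a ≡ + 1
sign-double (inj₁ a≡1) _ = a≡1
sign-double (inj₂ refl) ()

-- Summed over the columns k, the products (H r k + H s k)(H r k + H t k) leave only the norm m of
-- row r, by orthogonality, and each product is a multiple of 4. Distinctness of the rows is phrased
-- through `scalarId`, so that concrete rows satisfy it by `refl`.
hadamard-order : ∀ {m} {H : Matrix m} → (∀ i j → IsSign (H i j)) →
                 (∀ i j → (H · transpose H) i j ≡ scalarId (+ m) i j) →
                 ∀ r s t → scalarId (+ m) r s ≡ + 0 → scalarId (+ m) r t ≡ + 0 → scalarId (+ m) s t ≡ + 0 →
                 ∃[ e ] m ≡ 4 ℕ.* e
hadamard-order {m} {H} sign gram r s t rs rt st =
  finish (∑-multiple (+ 4) (λ k → sign-product (sign r k) (sign s k) (sign t k)))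
  where
  G : Matrix m
  G = H · transpose H
  expand : ∑ (λ k → (H r k + H s k) * (H r k + H t k)) ≡ + m
  expand = begin
    ∑ (λ k → (H r k + H s k) * (H r k + H t k))
      ≡⟨ ∑-cong (λ k → distribute (H r k) (H s k) (H t k)) ⟩
    ∑ (λ k → (H r k * H r k + H r k * H t k) + (H r k * H s k + H s k * H t k))
      ≡⟨ ∑-+ (λ k → H r k * H r k + H r k * H t k) (λ k → H r k * H s k + H s k * H t k) ⟩
    ∑ (λ k → H r k * H r k + H r k * H t k) + ∑ (λ k → H r k * H s k + H s k * H t k)
      ≡⟨ cong₂ _+_ (∑-+ (λ k → H r k * H r k) (λ k → H r k * H t k)) (∑-+ (λ k → H r k * H s k) (λ k → H s k * H t k)) ⟩
    (G r r + G r t) + (G r s + G s t)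
      ≡⟨ cong₂ _+_ (cong₂ _+_ (trans (gram r r) (scalarId-diagonal (+ m) r)) (trans (gram r t) rt))
                   (cong₂ _+_ (trans (gram r s) rs) (trans (gram s t) st)) ⟩
    (+ m + + 0) + + 0
      ≡⟨ trans (ℤₚ.+-identityʳ _) (ℤₚ.+-identityʳ _) ⟩
    + m ∎
    where
    distribute : ∀ a b c → (a + b) * (a + c) ≡ (a * a + a * c) + (a * b + b * c)
    distribute = solve-∀
  finish : (∃[ e ] ∑ (λ k → (H r k + H s k) * (H r k + H t k)) ≡ + 4 * e) → ∃[ e ] m ≡ 4 ℕ.* e
  finish (e , ∑≡4e) = ∣ e ∣ , trans (cong ∣_∣ (trans (sym expand) ∑≡4e)) (ℤₚ.abs-* (+ 4) e)

pred[4e]≡3-mod-4 : ∀ m → m ≢ 0 → (∃[ e ] m ≡ 4 ℕ.* e) → (m ℕ.∸ 1) % 4 ≡ 3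
pred[4e]≡3-mod-4 m m≢0 (zero , m≡0) = contradiction m≡0 m≢0
pred[4e]≡3-mod-4 m _ (suc e , refl) = trans (cong (λ x → (x ℕ.∸ 1) % 4) (ℕₚ.*-comm 4 (suc e))) ([m+kn]%n≡m%n 3 e 4)

module _ {n : ℕ} .{{_ : NonZero n}} {M : Matrix n} (neg : IsNegacirculant n M) where

  rowDependent⇒kernel : RowDependent M → Σ[ d ∈ (Fin n → ℤ) ] (∃[ i ] d i ≢ + 0) × (∀ i → (M ∙ d) i ≡ + 0)
  rowDependent⇒kernel (u , (i₀ , ui₀≢0) , uM≡0) =
    u ∘ opposite , (opposite i₀ , λ e → ui₀≢0 (trans (cong u (sym (opposite-involutive i₀))) e)) , λ i → begin
      ∑ (λ j → M i j * u (opposite j))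
        ≡⟨ ∑-cong (λ j → trans (cong (_* u (opposite j)) (sym (negacirculant-opposite neg i j))) (ℤₚ.*-comm _ (u (opposite j)))) ⟩
      ∑ (λ j → u (opposite j) * M (opposite j) (opposite i))
        ≡⟨ ∑-opposite (λ j → u j * M j (opposite i)) ⟩
      ∑ (λ j → u j * M j (opposite i))
        ≡⟨ uM≡0 (opposite i) ⟩
      + 0 ∎

module _ (n : ℕ) (H : Matrix (n ℕ.+ n)) (P Q R : Matrix n)
         (skewHadamard : IsSkewHadamard (n ℕ.+ n) H)
         (H₁₁ : ∀ i j → H (i ↑ˡ n) (j ↑ˡ n) ≡ P i j)
         (H₁₂ : ∀ i j → H (i ↑ˡ n) (n ↑ʳ j) ≡ Q i j)
         (H₂₁ : ∀ i j → H (n ↑ʳ i) (j ↑ˡ n) ≡ - Q j i)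
         (H₂₂ : ∀ i j → H (n ↑ʳ i) (n ↑ʳ j) ≡ R j i) where
  private
    orthogonal = proj₁ (proj₂ skewHadamard)

  block-skew : ∀ i j → (R ⊕ transpose R) i j ≡ scalarId (+ 2) i j
  block-skew i j = begin
    R i j + R j i                                              ≡⟨ ℤₚ.+-comm (R i j) (R j i) ⟩
    R j i + R i j                                              ≡⟨ cong₂ _+_ (H₂₂ i j) (H₂₂ j i) ⟨
    H (n ↑ʳ i) (n ↑ʳ j) + H (n ↑ʳ j) (n ↑ʳ i)                  ≡⟨ proj₂ (proj₂ skewHadamard) (n ↑ʳ i) (n ↑ʳ j) ⟩
    scalarId (+ 2) (n ↑ʳ i) (n ↑ʳ j)                           ≡⟨ scalarId-↑ʳ n (+ 2) i j ⟩
    scalarId (+ 2) i j                                         ∎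

  -- Inner products of the lower rows (-Qᵀ, Rᵀ) of H, in which the two signs before Q cancel.
  block-gram : ∀ i j → ((transpose Q · Q) ⊕ (transpose R · R)) i j ≡ scalarId (+ (n ℕ.+ n)) i j
  block-gram i j = begin
    ∑ (λ k → Q k i * Q k j) + ∑ (λ k → R k i * R k j)
      ≡⟨ cong₂ _+_ (∑-cong λ k → trans (sym (neg*neg (Q k i) (Q k j))) (sym (cong₂ _*_ (H₂₁ i k) (H₂₁ j k))))
                   (∑-cong λ k → sym (cong₂ _*_ (H₂₂ i k) (H₂₂ j k))) ⟩
    ∑ (λ k → h (k ↑ˡ n)) + ∑ (λ k → h (n ↑ʳ k))
      ≡⟨ ∑-split n h ⟨
    ∑ h
      ≡⟨ orthogonal (n ↑ʳ i) (n ↑ʳ j) ⟩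
    scalarId (+ (n ℕ.+ n)) (n ↑ʳ i) (n ↑ʳ j)
      ≡⟨ scalarId-↑ʳ n (+ (n ℕ.+ n)) i j ⟩
    scalarId (+ (n ℕ.+ n)) i j ∎
    where
    h : Fin (n ℕ.+ n) → ℤ
    h k = H (n ↑ʳ i) k * H (n ↑ʳ j) k

  -- Upper rows (P, Q) are orthogonal to lower rows (-Qᵀ, Rᵀ), that is, -PQ + QR = 0.
  block-intertwine : ∀ i j → (Q · R) i j ≡ (P · Q) i j
  block-intertwine i j = begin
    ∑ (λ k → Q i k * R k j)
      ≡⟨ isolate ((P · Q) i j) ((Q · R) i j) ⟩
    (P · Q) i j + (- + 1 * (P · Q) i j + (Q · R) i j)
      ≡⟨ cong (λ z → (P · Q) i j + (z + (Q · R) i j)) (∑-*ˡ (- + 1) (λ k → P i k * Q k j)) ⟨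
    (P · Q) i j + (∑ (λ k → - + 1 * (P i k * Q k j)) + (Q · R) i j)
      ≡⟨ cong (λ z → (P · Q) i j + z) (cong₂ _+_
           (∑-cong λ k → trans (move (P i k) (Q k j)) (sym (cong₂ _*_ (H₁₁ i k) (H₂₁ j k))))
           (∑-cong λ k → sym (cong₂ _*_ (H₁₂ i k) (H₂₂ j k)))) ⟩
    (P · Q) i j + (∑ (λ k → h (k ↑ˡ n)) + ∑ (λ k → h (n ↑ʳ k)))
      ≡⟨ cong (λ z → (P · Q) i j + z) (trans (sym (∑-split n h))
           (trans (orthogonal (i ↑ˡ n) (n ↑ʳ j)) (scalarId-↑ˡ-↑ʳ (+ (n ℕ.+ n)) i j))) ⟩
    (P · Q) i j + + 0
      ≡⟨ ℤₚ.+-identityʳ _ ⟩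
    (P · Q) i j ∎
    where
    h : Fin (n ℕ.+ n) → ℤ
    h k = H (i ↑ˡ n) k * H (n ↑ʳ j) k
    isolate : ∀ x y → y ≡ x + (- + 1 * x + y)
    isolate = solve-∀
    move : ∀ x y → - + 1 * (x * y) ≡ x * - y
    move = solve-∀

theorem4p23 : (n : ℕ) (H : Matrix (n ℕ.+ n)) (P Q R : Matrix n)
    → IsNegacirculant n P → IsNegacirculant n Q → IsNegacirculant n R
    → IsSkewHadamard (n ℕ.+ n) H
    → (∀ i j → H (i ↑ˡ n) (j ↑ˡ n) ≡ P i j)
    → (∀ i j → H (i ↑ˡ n) (n ↑ʳ j) ≡ Q i j)
    → (∀ i j → H (n ↑ʳ i) (j ↑ˡ n) ≡ - Q j i)
    → (∀ i j → H (n ↑ʳ i) (n ↑ʳ j) ≡ R j i)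
    → Nonsingular Q × (∀ i j → R i j ≡ P i j)
theorem4p23 zero H P Q R _ _ _ _ _ _ _ _ = (λ ()) , λ ()
-- For n = 1 there is no third row, and 2n - 1 = 1 has no prime divisor. Skewness makes both
-- diagonal entries of H equal to 1, and Q is a single sign.
theorem4p23 (suc zero) H P Q R _ _ _ (sign , _ , skew) H₁₁ H₁₂ _ H₂₂ =
  nonsingular (subst IsSign (H₁₂ zero zero) (sign _ _)) , λ { zero zero → begin
    R zero zero             ≡⟨ H₂₂ zero zero ⟨
    H (suc zero) (suc zero) ≡⟨ sign-double (sign _ _) (skew (suc zero) (suc zero)) ⟩
    + 1                     ≡⟨ sign-double (sign _ _) (skew zero zero) ⟨
    H zero zero             ≡⟨ H₁₁ zero zero ⟩
    P zero zero             ∎ }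
  where
  nonsingular : IsSign (Q zero zero) → Nonsingular Q
  nonsingular (inj₁ Q≡1) rewrite Q≡1 = λ ()
  nonsingular (inj₂ Q≡-1) rewrite Q≡-1 = λ ()
theorem4p23 n@(suc (suc _)) H P Q R negP negQ negR skewHadamard@(sign , orthogonal , _) H₁₁ H₁₂ H₂₁ H₂₂ =
  (λ detQ≡0 → nonzero (rowDependent⇒kernel negQ (singular⇒rowDependent Q detQ≡0))) , λ i j → begin
    R i j                          ≡⟨ isolate (R i j) (P i j) ⟩
    (R i j + - + 1 * P i j) + P i j  ≡⟨ cong (_+ P i j) (kernel (D j) (QD≡0 j) i) ⟩
    + 0 + P i j                    ≡⟨ ℤₚ.+-identityˡ (P i j) ⟩
    P i j                          ∎
  where
  kernel : ∀ d → (∀ i → (Q ∙ d) i ≡ + 0) → ∀ i → d i ≡ + 0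
  kernel = kernel-trivial {Q = Q} negR (block-skew n H P Q R skewHadamard H₁₁ H₁₂ H₂₁ H₂₂)
    (block-gram n H P Q R skewHadamard H₁₁ H₁₂ H₂₁ H₂₂)
    -- Rows 0, 1 and n of H are distinct because n is at least 2; hence 4 divides 2n.
    (pred[4e]≡3-mod-4 (n ℕ.+ n) (λ ()) (hadamard-order sign orthogonal zero (suc zero) (n ↑ʳ zero) refl refl refl))
  nonzero : Σ[ d ∈ (Fin n → ℤ) ] (∃[ i ] d i ≢ + 0) × (∀ i → (Q ∙ d) i ≡ + 0) → ⊥
  nonzero (d , (i , di≢0) , Qd≡0) = di≢0 (kernel d Qd≡0 i)
  -- Column j of R - P. It is killed by Q, so the triviality of the kernel gives R = P without an
  -- inverse of Q.
  D : Fin n → Fin n → ℤ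
  D j k = R k j + - + 1 * P k j
  isolate : ∀ x y → x ≡ (x + - + 1 * y) + y
  isolate = solve-∀
  QD≡0 : ∀ j i → (Q ∙ D j) i ≡ + 0
  QD≡0 j i = begin
    ∑ (λ k → Q i k * D j k)
      ≡⟨ ∑-cong (λ k → distribute (Q i k) (R k j) (P k j)) ⟩
    ∑ (λ k → Q i k * R k j + - + 1 * (Q i k * P k j))
      ≡⟨ ∑-+ (λ k → Q i k * R k j) (λ k → - + 1 * (Q i k * P k j)) ⟩
    (Q · R) i j + ∑ (λ k → - + 1 * (Q i k * P k j))
      ≡⟨ cong₂ _+_ (block-intertwine n H P Q R skewHadamard H₁₁ H₁₂ H₂₁ H₂₂ i j) (∑-*ˡ (- + 1) (λ k → Q i k * P k j)) ⟩
    (P · Q) i j + - + 1 * (Q · P) i j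
      ≡⟨ cong (_+ - + 1 * (Q · P) i j) (negacirculant-·-comm negP negQ i j) ⟩
    (Q · P) i j + - + 1 * (Q · P) i j
      ≡⟨ cancel ((Q · P) i j) ⟩
    + 0 ∎
    where
    distribute : ∀ q r p → q * (r + - + 1 * p) ≡ q * r + - + 1 * (q * p)
    distribute = solve-∀
    cancel : ∀ x → x + - + 1 * x ≡ + 0
    cancel = solve-∀
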